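{- Let $K$ be the class of cotorsionfree abelian groups. There is no class $C$ of abelian groups such that $K={}^\perp C$.
   Context: For a class $C$ of abelian groups, ${}^\perp C=\{G : G \text{ an abelian group and } \mathrm{Ext}(G,X)=0\text{ for all }X\in C\}$. A group $G$ is cotorsion if $\mathrm{Ext}(J,G)=0$ for every torsionfree abelian group $J$; it is cotorsionfree if it has no nonzero cotorsion subgroup (equivalently, no subgroup isomorphic to $\mathbb{Q}$, $\mathbb{Z}/p\mathbb{Z}$ or the $p$-adic integers $J_p$, for any prime $p$). -}

module Defs where

open import Algebra.Bundles using (AbelianGroup)
open import Algebra.Morphism.Bundles using (GroupHomomorphism)
open import Algebra.Morphism.Structures using (IsGroupHomomorphism; IsGroupMonomorphism)
import Algebra.Construct.DirectProduct as DirectProduct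
import Algebra.Properties.Group as GroupProperties
import Algebra.Properties.Monoid.Mult as Mult
open import Data.Nat.Base using (ℕ; NonZero)
open import Data.Product.Base using (_,_; proj₁; proj₂; ∃; Σ-syntax)
open import Function.Base using (id; _∘_)
open import Function.Bundles using (Func; Surjection; Equivalence; _⇔_; mk⇔)
open import Function.Definitions using (Surjective; StrictlyInverseˡ)
open import Level using (Level; suc)
open import Relation.Binary.Bundles using (Setoid)
open import Relation.Binary.Structures using (IsEquivalence)
open import Relation.Unary using (Pred)
import Relation.Binary.Reasoning.Setoid as ≈-Reasoning

private
  variable
    ℓ m : Level

-- The axiom of choice for sets, a set being a setoid: every surjection has a
-- right inverse.  The right inverse is a `Func`, so it has to respect the
-- equality of `T`.  This makes the axiom independent of type theory, where
-- `Surjection.to⁻` is only a function on carriers, and makes it imply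
-- excluded middle at level ℓ (Diaconescu).

AxiomOfChoice : (ℓ : Level) → Set (suc ℓ)
AxiomOfChoice ℓ =
  (S T : Setoid ℓ ℓ) (f : Surjection S T) →
  Σ[ g ∈ Func T S ] StrictlyInverseˡ (Setoid._≈_ T) (Surjection.to f) (Func.to g)

Hom : AbelianGroup ℓ ℓ → AbelianGroup ℓ ℓ → Set ℓ
Hom A B = GroupHomomorphism (AbelianGroup.rawGroup A) (AbelianGroup.rawGroup B)

-- Short exact sequences 0 → X → E → G → 0.

record Extension (G X : AbelianGroup ℓ ℓ) : Set (suc ℓ) where
  private
    module G = AbelianGroup G
    module X = AbelianGroup X
  field
    E : AbelianGroup ℓ ℓ
  module E = AbelianGroup E
  field
    ι                   : X.Carrier → E.Carrier
    π                   : E.Carrier → G.Carrier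
    ι-isMonomorphism    : IsGroupMonomorphism X.rawGroup E.rawGroup ι
    π-isHomomorphism    : IsGroupHomomorphism E.rawGroup G.rawGroup π
    π-surjective        : Surjective E._≈_ G._≈_ π
    exact               : ∀ e → π e G.≈ G.ε ⇔ (∃ λ x → ι x E.≈ e)

  module ι = IsGroupMonomorphism ι-isMonomorphism
  module π = IsGroupHomomorphism π-isHomomorphism

-- Such a morphism is automatically an isomorphism; see `≃-sym`.

record _≃_ {G X : AbelianGroup ℓ ℓ} (P Q : Extension G X) : Set ℓ where
  private
    module G = AbelianGroup G
    module P = Extension P
    module Q = Extension Q
  field
    hom : Hom P.E Q.E
  open GroupHomomorphism hom public
  field
    commutes-ι : ∀ x → ⟦ P.ι x ⟧ Q.E.≈ Q.ι x
    commutes-π : ∀ e → Q.π ⟦ e ⟧ G.≈ P.π e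

module _ {G X : AbelianGroup ℓ ℓ} where

  private
    module G = AbelianGroup G

  ≃-refl : {P : Extension G X} → P ≃ P
  ≃-refl {P} = record
    { hom = record
      { ⟦_⟧ = id
      ; isGroupHomomorphism = record
        { isMonoidHomomorphism = record
          { isMagmaHomomorphism = record
            { isRelHomomorphism = record { cong = id }
            ; homo = λ _ _ → P.E.refl
            }
          ; ε-homo = P.E.refl
          }
        ; ⁻¹-homo = λ _ → P.E.refl
        }
      }
    ; commutes-ι = λ _ → P.E.refl
    ; commutes-π = λ _ → G.refl
    } where module P = Extension P

  ≃-trans : {P Q R : Extension G X} → P ≃ Q → Q ≃ R → P ≃ R
  ≃-trans {P} {Q} {R} α β = record
    { hom = record
      { ⟦_⟧ = β.⟦_⟧ ∘ α.⟦_⟧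
      ; isGroupHomomorphism = record
        { isMonoidHomomorphism = record
          { isMagmaHomomorphism = record
            { isRelHomomorphism = record { cong = β.⟦⟧-cong ∘ α.⟦⟧-cong }
            ; homo = λ x y → R.trans (β.⟦⟧-cong (α.homo x y)) (β.homo _ _)
            }
          ; ε-homo = R.trans (β.⟦⟧-cong α.ε-homo) β.ε-homo
          }
        ; ⁻¹-homo = λ x → R.trans (β.⟦⟧-cong (α.⁻¹-homo x)) (β.⁻¹-homo _)
        }
      }
    ; commutes-ι = λ x → R.trans (β.⟦⟧-cong (α.commutes-ι x)) (β.commutes-ι x)
    ; commutes-π = λ e → G.trans (β.commutes-π _) (α.commutes-π e)
    } where
      module α = _≃_ α
      module β = _≃_ β
      module R = AbelianGroup (Extension.E R)

  ≃-sym : {P Q : Extension G X} → P ≃ Q → Q ≃ P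
  ≃-sym {P} {Q} β = record
    { hom = record
      { ⟦_⟧ = γ
      ; isGroupHomomorphism = record
        { isMonoidHomomorphism = record
          { isMagmaHomomorphism = record
            { isRelHomomorphism = record
              { cong = λ {x} {y} x≈y → injective
                  (F.trans (βγ x) (F.trans x≈y (F.sym (βγ y)))) }
            ; homo = λ x y → injective (F.trans (βγ (x F.∙ y))
                (F.sym (F.trans (β.homo _ _) (F.∙-cong (βγ x) (βγ y)))))
            }
          ; ε-homo = injective (F.trans (βγ F.ε) (F.sym β.ε-homo))
          }
        ; ⁻¹-homo = λ x → injective (F.trans (βγ (x F.⁻¹))
            (F.sym (F.trans (β.⁻¹-homo _) (F.⁻¹-cong (βγ x)))))
        }
      }
    ; commutes-ι = λ x → injective (F.trans (βγ (Q.ι x)) (F.sym (β.commutes-ι x)))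
    ; commutes-π = λ e →
        G.trans (G.sym (β.commutes-π (γ e))) (Q.π.⟦⟧-cong (βγ e))
    } where
      module P = Extension P
      module Q = Extension Q
      module E = P.E
      module F = Q.E
      module X = AbelianGroup X
      module β = _≃_ β
      module EP = GroupProperties E.group
      module FP = GroupProperties F.group

      kernel : ∀ e → β.⟦ e ⟧ F.≈ F.ε → e E.≈ E.ε
      kernel e βe≈ε = E.trans (E.sym ιx≈e) (E.trans (P.ι.⟦⟧-cong x≈ε) P.ι.ε-homo)
        where
        πe≈ε : P.π e G.≈ G.ε
        πe≈ε = G.trans (G.sym (β.commutes-π e))
                 (G.trans (Q.π.⟦⟧-cong βe≈ε) Q.π.ε-homo)
        x = proj₁ (Equivalence.to (P.exact e) πe≈ε)
        ιx≈e = proj₂ (Equivalence.to (P.exact e) πe≈ε)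
        x≈ε : x X.≈ X.ε
        x≈ε = Q.ι.injective (F.trans (F.sym (β.commutes-ι x))
                (F.trans (β.⟦⟧-cong ιx≈e) (F.trans βe≈ε (F.sym Q.ι.ε-homo))))

      injective : ∀ {e e′} → β.⟦ e ⟧ F.≈ β.⟦ e′ ⟧ → e E.≈ e′
      injective {e} {e′} βe≈βe′ = EP.x∙y⁻¹≈ε⇒x≈y e e′ (kernel _ (begin
        β.⟦ e E.∙ e′ E.⁻¹ ⟧          ≈⟨ β.homo e (e′ E.⁻¹) ⟩
        β.⟦ e ⟧ F.∙ β.⟦ e′ E.⁻¹ ⟧    ≈⟨ F.∙-cong βe≈βe′ (β.⁻¹-homo e′) ⟩
        β.⟦ e′ ⟧ F.∙ β.⟦ e′ ⟧ F.⁻¹   ≈⟨ F.inverseʳ _ ⟩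
        F.ε                          ∎))
        where open ≈-Reasoning F.setoid

      surjective : ∀ f → ∃ λ e → β.⟦ e ⟧ F.≈ f
      surjective f = P.ι x E.∙ e , (begin
        β.⟦ P.ι x E.∙ e ⟧                   ≈⟨ β.homo _ _ ⟩
        β.⟦ P.ι x ⟧ F.∙ β.⟦ e ⟧             ≈⟨ F.∙-congʳ (β.commutes-ι x) ⟩
        Q.ι x F.∙ β.⟦ e ⟧                   ≈⟨ F.∙-congʳ ιx≈d ⟩
        (f F.∙ β.⟦ e ⟧ F.⁻¹) F.∙ β.⟦ e ⟧    ≈⟨ FP.//-rightDividesˡ β.⟦ e ⟧ f ⟩
        f                                   ∎)
        where
        open ≈-Reasoning F.setoid
        e = proj₁ (P.π-surjective (Q.π f))
        πe≈πf : P.π e G.≈ Q.π f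
        πe≈πf = proj₂ (P.π-surjective (Q.π f)) E.refl
        d = f F.∙ β.⟦ e ⟧ F.⁻¹
        πd≈ε : Q.π d G.≈ G.ε
        πd≈ε = G.trans (Q.π.homo _ _) (G.trans
          (G.∙-congˡ (G.trans (Q.π.⁻¹-homo _)
            (G.⁻¹-cong (G.trans (β.commutes-π e) πe≈πf))))
          (G.inverseʳ _))
        x = proj₁ (Equivalence.to (Q.exact d) πd≈ε)
        ιx≈d = proj₂ (Equivalence.to (Q.exact d) πd≈ε)

      γ : F.Carrier → E.Carrier
      γ = proj₁ ∘ surjective
      βγ : ∀ f → β.⟦ γ f ⟧ F.≈ f
      βγ = proj₂ ∘ surjective

-- The underlying set of Yoneda's Ext¹(G, X).

Ext : (G X : AbelianGroup ℓ ℓ) → Setoid (suc ℓ) ℓ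
Ext G X = record
  { Carrier       = Extension G X
  ; _≈_           = _≃_
  ; isEquivalence = record { refl = ≃-refl ; sym = ≃-sym ; trans = ≃-trans }
  }

-- The zero of Ext(G, X) for Baer addition: 0 → X → X ⊕ G → G → 0.

0ᴱ : (G X : AbelianGroup ℓ ℓ) → Extension G X
0ᴱ G X = record
  { E = DirectProduct.abelianGroup X G
  ; ι = λ x → x , G.ε
  ; π = proj₂
  ; ι-isMonomorphism = record
    { isGroupHomomorphism = record
      { isMonoidHomomorphism = record
        { isMagmaHomomorphism = record
          { isRelHomomorphism = record { cong = λ x≈y → x≈y , G.refl }
          ; homo = λ _ _ → X.refl , G.sym (G.identityˡ G.ε)
          }
        ; ε-homo = X.refl , G.refl
        }
      ; ⁻¹-homo = λ _ → X.refl , G.sym (GroupProperties.ε⁻¹≈ε G.group)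
      }
    ; injective = proj₁
    }
  ; π-isHomomorphism = record
    { isMonoidHomomorphism = record
      { isMagmaHomomorphism = record
        { isRelHomomorphism = record { cong = proj₂ }
        ; homo = λ _ _ → G.refl
        }
      ; ε-homo = G.refl
      }
    ; ⁻¹-homo = λ _ → G.refl
    }
  ; π-surjective = λ g → (X.ε , g) , proj₂
  ; exact = λ (x , g) → mk⇔
      (λ g≈ε → x , X.refl , G.sym g≈ε)
      (λ (_ , _ , ε≈g) → G.sym ε≈g)
  } where
    module G = AbelianGroup G
    module X = AbelianGroup X

Ext≡0 : (G X : AbelianGroup ℓ ℓ) → Set (suc ℓ)
Ext≡0 G X = ∀ P → P ≈ 0ᴱ G X
  where open Setoid (Ext G X) using (_≈_)

-- ⊥ C is the class usually written with C's left superscript ⊥.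

infix 9 ⊥_

⊥_ : Pred (AbelianGroup ℓ ℓ) m → Pred (AbelianGroup ℓ ℓ) _
(⊥ C) G = ∀ X → C X → Ext≡0 G X

TorsionFree : Pred (AbelianGroup ℓ ℓ) ℓ
TorsionFree G = ∀ (n : ℕ) .{{_ : NonZero n}} x → n × x ≈ ε → x ≈ ε
  where open AbelianGroup G using (_≈_; ε; monoid)
        open Mult monoid using (_×_)

Cotorsion : Pred (AbelianGroup ℓ ℓ) (suc ℓ)
Cotorsion G = ∀ J → TorsionFree J → Ext≡0 J G

-- Up to isomorphism, a subgroup of G is a group with a monomorphism into G.

record Subgroup (G : AbelianGroup ℓ ℓ) : Set (suc ℓ) where
  field
    group          : AbelianGroup ℓ ℓ
    inclusion      : AbelianGroup.Carrier group → AbelianGroup.Carrier G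
    isMonomorphism : IsGroupMonomorphism
                       (AbelianGroup.rawGroup group) (AbelianGroup.rawGroup G) inclusion

IsZero : Pred (AbelianGroup ℓ ℓ) ℓ
IsZero G = ∀ x → x ≈ ε
  where open AbelianGroup G using (_≈_; ε)

CotorsionFree : Pred (AbelianGroup ℓ ℓ) (suc ℓ)
CotorsionFree G = ∀ (H : Subgroup G) → Cotorsion (Subgroup.group H) → IsZero (Subgroup.group H)

{-# OPTIONS --safe #-}
module Submission where

open import Defs
open import Algebra.Bundles using (AbelianGroup; RawGroup)
import Algebra.Construct.DirectProduct as DirectProduct
import Algebra.Construct.Pointwise as Pointwise
import Algebra.Morphism.GroupMonomorphism as GroupMonomorphism
open import Algebra.Morphism.Structures using (IsGroupHomomorphism; IsGroupMonomorphism)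
import Algebra.Properties.AbelianGroup as AbelianGroupProperties
import Algebra.Properties.CommutativeMonoid.Mult as Mult
import Algebra.Properties.CommutativeSemigroup as CommutativeSemigroupProperties
import Algebra.Properties.Group as GroupProperties
open import Data.Bool.Base using (Bool; true; false; T; if_then_else_)
import Data.Bool.Properties as Bool
open import Data.Integer.Base as ℤ using (ℤ; +_; -[1+_]; _⊖_)
open import Data.Integer.Properties as ℤ using (+-0-abelianGroup; [1+m]⊖[1+n]≡m⊖n)
open import Data.List.Base using (List; []; _∷_; _++_)
open import Data.List.Relation.Unary.Any using (Any; here; there)
open import Data.List.Relation.Unary.Any.Properties using (++⁺ˡ; ++⁺ʳ)
open import Data.Nat.Base as ℕ using (ℕ; zero; suc; _!)
import Data.Nat.Properties as ℕ
open import Data.Product.Base using (_,_; _×_; proj₁; proj₂; ∃; Σ-syntax)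
open import Data.Product.Relation.Binary.Pointwise.NonDependent using (×-setoid)
open import Data.Rational.Unnormalised.Base as ℚ using (mkℚᵘ; *≡*; 1ℚᵘ)
import Data.Rational.Unnormalised.Properties as ℚ
open import Data.Sum.Base using (_⊎_; inj₁; inj₂)
open import Data.Unit.Polymorphic.Base using (⊤)
open import Function.Base using (id; _∘_; _on_)
open import Function.Bundles using (Func; _⟨$⟩_; mk⇔; Equivalence)
open import Function.Relation.Binary.Setoid.Equality using (_⇨_)
open import Level using (Level; 0ℓ; Lift; lift; lower; _⊔_) renaming (suc to lsuc)
open import Relation.Binary.Bundles using (Setoid)
open import Relation.Binary.Core using (Rel)
open import Relation.Binary.Definitions using (Reflexive; Transitive)
open import Relation.Binary.PropositionalEquality as ≡ using (_≡_)
import Relation.Binary.Reasoning.Setoid as ≈-Reasoning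
open import Relation.Nullary.Decidable
  using (Dec; yes; no; map′; isYes; toWitness; fromWitness; decidable-stable)
open import Relation.Nullary.Negation using (¬_; contradiction)
open import Relation.Unary using (Pred; _≐_; _⊆_)

-- Call X solvable if every system z n = p n + (n + 1) z (n + 1) has a solution in
-- X; this forces Ext(ℚ, X) = 0.  For every X there is a torsion-free, cotorsion-free
-- group B with: Ext(B, X) = 0 implies that X is solvable.  So if ⊥C is the class of
-- cotorsion-free groups, all members of C are solvable and ℚ ∈ ⊥C, although ℚ is
-- injective and hence cotorsion.
--
-- B comes from a diagonal argument on a tree whose nodes of level n are the functions
-- from lower levels to X, so that a branch is a function h from all nodes to X.  It
-- is generated by the nodes and elements y(h,n) = (n + 1) y(h,n+1) + [h|n].  Given p,
-- twist these relations by p n - h(h|n) ∈ X.  A splitting of the resulting extension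
-- restricts to a function h on the nodes, and at this branch the terms h(h|n) cancel,
-- leaving a solution for p.
--
-- B embeds into a power of ℤ, and ℤ contains no nonzero image of a solvable group.
-- A cotorsion subgroup H of B is solvable by the same construction, applied to H
-- in place of X; hence H = 0.

private
  variable
    ℓ a b c d p q : Level

-- Excluded middle from choice.

ExcludedMiddle : (ℓ : Level) → Set (lsuc ℓ)
ExcludedMiddle ℓ = {A : Set ℓ} → Dec A

-- Diaconescu: choose representatives of the quotient of Bool that identifies
-- true with false exactly when A holds.

choice⇒em : AxiomOfChoice ℓ → ExcludedMiddle ℓ
choice⇒em {ℓ} choice {A} = map′ true~false⇒A (λ a → ≡.cong lower (g.cong (inj₂ a)))
  (g′ true Bool.≟ g′ false)
  where
  _~_ : Rel (Lift ℓ Bool) ℓ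
  x ~ y = x ≡ y ⊎ A

  bools quotient : Setoid ℓ ℓ
  bools    = ≡.setoid (Lift ℓ Bool)
  quotient = record
    { Carrier       = Lift ℓ Bool
    ; _≈_           = _~_
    ; isEquivalence = record
      { refl  = inj₁ ≡.refl
      ; sym   = λ { (inj₁ p) → inj₁ (≡.sym p) ; (inj₂ a) → inj₂ a }
      ; trans = λ { (inj₁ p) (inj₁ q) → inj₁ (≡.trans p q)
                  ; (inj₁ _) (inj₂ a) → inj₂ a
                  ; (inj₂ a) _        → inj₂ a }
      }
    }

  section = choice bools quotient record
    { to         = id
    ; cong       = inj₁
    ; surjective = λ y → y , inj₁
    }
  module g = Func (proj₁ section)

  g′ : Bool → Bool
  g′ b = lower (g.to (lift b))

  true~false⇒A : g′ true ≡ g′ false → A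
  true~false⇒A eq with proj₂ section (lift true) | proj₂ section (lift false)
  ... | inj₂ a | _      = a
  ... | inj₁ _ | inj₂ a = a
  ... | inj₁ p | inj₁ q =
    contradiction (≡.trans (≡.sym (≡.cong lower p)) (≡.trans eq (≡.cong lower q))) λ ()

-- Zorn's lemma for preorders, by the Bourbaki-Witt argument.

module Zorn (choice : AxiomOfChoice ℓ) (P : Set ℓ) (_≤_ : Rel P ℓ)
            (≤-refl : Reflexive _≤_) (≤-trans : Transitive _≤_) where

  private
    em : ExcludedMiddle ℓ
    em = choice⇒em choice

  Chain : Pred (Pred P ℓ) ℓ
  Chain C = ∀ {x y} → C x → C y → x ≤ y ⊎ y ≤ x

  -- The level `k` is free so that this applies both to chains and to Boolean subsets `T ∘ C`.
  IsLub : ∀ {k} → Pred P k → Pred P (ℓ ⊔ k)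
  IsLub C s = (∀ {x} → C x → x ≤ s) × (∀ {y} → (∀ {x} → C x → x ≤ y) → s ≤ y)

  Maximal : Pred P ℓ
  Maximal x = ∀ y → x ≤ y → y ≤ x

  ≤-setoid : Setoid ℓ ℓ
  ≤-setoid = record
    { Carrier       = P
    ; _≈_           = λ x y → x ≤ y × y ≤ x
    ; isEquivalence = record
      { refl  = ≤-refl , ≤-refl
      ; sym   = λ (p , q) → q , p
      ; trans = λ (p , q) (p′ , q′) → ≤-trans p p′ , ≤-trans q′ q
      }
    }

  -- A step may stand still only at a maximal point, so a point that `next` does not raise is
  -- maximal.
  Step : Rel P ℓ
  Step x y = x ≤ y × (y ≤ x → Maximal x)

  step : ∀ x → ∃ (Step x)
  step x with em {∃ λ y → x ≤ y × ¬ y ≤ x}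
  ... | yes (y , x≤y , y≰x) = y , x≤y , λ y≤x → contradiction y≤x y≰x
  ... | no ∄y = x , ≤-refl , λ _ y x≤y → decidable-stable em λ y≰x → ∄y (y , x≤y , y≰x)

  open Setoid ≤-setoid using (_≈_) renaming (trans to ≈-trans)

  private
    -- Choice returns a step out of a point equivalent to `x`, not out of `x` itself. The equality
    -- of the source compares both ends of a step, so the chosen end respects equivalence; this
    -- gives `next-cong`.
    stepChoice : Σ[ g ∈ Func ≤-setoid _ ] _
    stepChoice = choice record
      { Carrier       = Σ[ x ∈ P ] ∃ (Step x)
      ; _≈_           = λ (x , y , _) (x′ , y′ , _) → x ≈ x′ × y ≈ y′
      ; isEquivalence = record
        { refl  = (≤-refl , ≤-refl) , (≤-refl , ≤-refl)
        ; sym   = λ ((a , b) , (c , d)) → (b , a) , (d , c)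
        ; trans = λ (p , q) (p′ , q′) → ≈-trans p p′ , ≈-trans q q′
        }
      } ≤-setoid record
      { to         = proj₁
      ; cong       = proj₁
      ; surjective = λ x → (x , step x) , proj₁
      }
    module g = Func (proj₁ stepChoice)

  next : P → P
  next x = proj₁ (proj₂ (g.to x))

  next-cong : ∀ {x y} → x ≈ y → next x ≈ next y
  next-cong x≈y = proj₂ (g.cong x≈y)

  ≤-next : ∀ x → x ≤ next x
  ≤-next x = ≤-trans (proj₂ (proj₂ stepChoice x)) (proj₁ (proj₂ (proj₂ (g.to x))))

  next≤⇒maximal : ∀ x → next x ≤ x → Maximal x
  next≤⇒maximal x next≤x y x≤y = ≤-trans
    (proj₂ (proj₂ (proj₂ (g.to x))) (≤-trans next≤x x≤x′) y (≤-trans x′≤x x≤y)) x′≤x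
    where
    x′≤x = proj₁ (proj₂ stepChoice x)
    x≤x′ = proj₂ (proj₂ stepChoice x)

  -- Subsets are indexed by Bool-valued functions so that Tower lives in Set ℓ.

  data Tower (x₀ : P) : Pred P ℓ where
    base : Tower x₀ x₀
    succ : ∀ {x} → Tower x₀ x → Tower x₀ (next x)
    lub  : ∀ (C : P → Bool) {s} → ∃ (T ∘ C) → (∀ x → T (C x) → Tower x₀ x) →
           IsLub (T ∘ C) s → Tower x₀ s

  module _ (x₀ : P) where

    x₀≤tower : ∀ {x} → Tower x₀ x → x₀ ≤ x
    x₀≤tower base     = ≤-refl
    x₀≤tower (succ t) = ≤-trans (x₀≤tower t) (≤-next _)
    x₀≤tower (lub C (x , Cx) t (upper , _)) = ≤-trans (x₀≤tower (t x Cx)) (upper Cx)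

    -- Stronger than comparability: nothing in the tower lies strictly between `y` and `next y`.
    -- This is the form that passes through the induction.
    _◁_ : Rel P ℓ
    x ◁ y = x ≤ y ⊎ next y ≤ x

    lub-◁ : ∀ {C : P → Bool} {s y} → IsLub (T ∘ C) s → (∀ x → T (C x) → x ◁ y) → s ◁ y
    lub-◁ {C} {s} {y} (upper , least) C◁y with em {∃ λ x → T (C x) × next y ≤ x}
    ... | yes (x , Cx , y′≤x) = inj₂ (≤-trans y′≤x (upper Cx))
    ... | no ∄x = inj₁ (least below)
      where
      below : ∀ {x} → T (C x) → x ≤ y
      below {x} Cx with C◁y x Cx
      ... | inj₁ x≤y  = x≤y
      ... | inj₂ y′≤x = contradiction (x , Cx , y′≤x) ∄x

    succ-◁ : ∀ {x y} → x ◁ y → y ◁ x → next x ◁ y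
    succ-◁ _            (inj₂ x′≤y) = inj₁ x′≤y
    -- Here `x` and `y` are equivalent but possibly distinct, so `next` has to respect equivalence.
    succ-◁ (inj₁ x≤y)   (inj₁ y≤x)  = inj₂ (proj₁ (next-cong (y≤x , x≤y)))
    succ-◁ (inj₂ y′≤x)  (inj₁ _)    = inj₂ (≤-trans y′≤x (≤-next _))

    -- The inner half of a double induction: `x` is fixed and already related to the whole tower,
    -- and the induction runs over `y`. The outer half is `◁-total`.
    tower-◁ : ∀ {x} → Tower x₀ x → (∀ {y} → Tower x₀ y → x ◁ y) →
              ∀ {y} → Tower x₀ y → y ◁ x
    tower-◁ t t◁ base              = inj₁ (x₀≤tower t)
    tower-◁ t t◁ (succ u)          = succ-◁ (tower-◁ t t◁ u) (t◁ u)
    tower-◁ t t◁ (lub C _ u isLub) = lub-◁ isLub λ y Cy → tower-◁ t t◁ (u y Cy)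

    ◁-total : ∀ {x y} → Tower x₀ x → Tower x₀ y → x ◁ y
    ◁-total base              u = inj₁ (x₀≤tower u)
    ◁-total (succ t)          u = succ-◁ (◁-total t u) (tower-◁ t (◁-total t) u)
    ◁-total (lub C _ t isLub) u = lub-◁ isLub λ x Cx → ◁-total (t x Cx) u

    tower-chain : Chain (Tower x₀)
    tower-chain {x} {y} t u with ◁-total t u
    ... | inj₁ x≤y  = inj₁ x≤y
    ... | inj₂ y′≤x = inj₂ (≤-trans (≤-next y) y′≤x)

  -- The tower over `x₀` is itself a chain. Its least upper bound `top` belongs to it, hence so does
  -- `next top`, which is therefore below `top`.
  zorn : P → (∀ C → ∃ C → Chain C → ∃ (IsLub C)) → ∃ Maximal
  zorn x₀ lubs = top , next≤⇒maximal top (upper (succ top∈))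
    where
    isTop = lubs (Tower x₀) (x₀ , base) (tower-chain x₀)
    top   = proj₁ isTop
    upper : ∀ {x} → Tower x₀ x → x ≤ top
    upper = proj₁ (proj₂ isTop)
    least = proj₂ (proj₂ isTop)

    -- Excluded middle turns the tower into a Boolean subset of itself, to which the constructor
    -- `lub` applies.
    top∈ : Tower x₀ top
    top∈ = lub (λ x → isYes (em {Tower x₀ x})) (x₀ , fromWitness base)
      (λ _ → toWitness) ((λ t → upper (toWitness t)) , λ below → least (λ t → below (fromWitness t)))

-- Homomorphisms and integer multiples in abelian groups.

mkHom : (A : AbelianGroup a b) (B : AbelianGroup c d) →
        let module A = AbelianGroup A ; module B = AbelianGroup B in
        (f : A.Carrier → B.Carrier) → (∀ {x y} → x A.≈ y → f x B.≈ f y) →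
        (∀ x y → f (x A.∙ y) B.≈ f x B.∙ f y) →
        IsGroupHomomorphism A.rawGroup B.rawGroup f
mkHom A B f cong homo = record
  { isMonoidHomomorphism = record
    { isMagmaHomomorphism = record { isRelHomomorphism = record { cong = cong } ; homo = homo }
    ; ε-homo              = ε-homo
    }
  ; ⁻¹-homo = λ x → BP.inverseˡ-unique _ _
      (B.trans (B.sym (homo _ _)) (B.trans (cong (A.inverseˡ x)) ε-homo))
  }
  where
  module A = AbelianGroup A
  module B = AbelianGroup B
  module BP = GroupProperties B.group
  ε-homo : f A.ε B.≈ B.ε
  ε-homo = BP.identityˡ-unique _ _ (B.trans (B.sym (homo _ _)) (cong (A.identityˡ A.ε)))

module ℤ-Action (G : AbelianGroup a b) where
  open AbelianGroup G
  open AbelianGroupProperties G public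
  open CommutativeSemigroupProperties commutativeSemigroup public using (interchange)
  open Mult commutativeMonoid public renaming (_×_ to infixr 8 _∗_)
  open ≈-Reasoning setoid

  infixr 8 _·_
  _·_ : ℤ → Carrier → Carrier
  (+ n)    · x = n ∗ x
  -[1+ n ] · x = (suc n ∗ x) ⁻¹

  ⁻¹-hom : IsGroupHomomorphism rawGroup rawGroup _⁻¹
  ⁻¹-hom = mkHom G G _⁻¹ ⁻¹-cong λ x y → sym (⁻¹-∙-comm x y)

  ·-congʳ : ∀ i {x y} → x ≈ y → i · x ≈ i · y
  ·-congʳ (+ n)    x≈y = ×-congʳ n x≈y
  ·-congʳ -[1+ n ] x≈y = ⁻¹-cong (×-congʳ (suc n) x≈y)

  ·-distribʳ : ∀ i x y → i · (x ∙ y) ≈ i · x ∙ i · y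
  ·-distribʳ (+ n)    x y = ×-distrib-+ x y n
  ·-distribʳ -[1+ n ] x y = trans (⁻¹-cong (×-distrib-+ x y (suc n))) (sym (⁻¹-∙-comm _ _))

  ·-hom : ∀ i → IsGroupHomomorphism rawGroup rawGroup (i ·_)
  ·-hom i = mkHom G G (i ·_) (·-congʳ i) (·-distribʳ i)

  ·-⊖ : ∀ m n x → (m ⊖ n) · x ≈ m ∗ x ∙ (n ∗ x) ⁻¹
  ·-⊖ zero    zero    x = sym (inverseʳ ε)
  ·-⊖ zero    (suc n) x = sym (identityˡ _)
  ·-⊖ (suc m) zero    x = sym (trans (∙-congˡ ε⁻¹≈ε) (identityʳ _))
  ·-⊖ (suc m) (suc n) x = begin
    (suc m ⊖ suc n) · x                     ≡⟨ ≡.cong (_· x) ([1+m]⊖[1+n]≡m⊖n m n) ⟩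
    (m ⊖ n) · x                             ≈⟨ ·-⊖ m n x ⟩
    m ∗ x ∙ (n ∗ x) ⁻¹                      ≈⟨ identityˡ _ ⟨
    ε ∙ (m ∗ x ∙ (n ∗ x) ⁻¹)                ≈⟨ ∙-congʳ (inverseʳ x) ⟨
    (x ∙ x ⁻¹) ∙ (m ∗ x ∙ (n ∗ x) ⁻¹)       ≈⟨ interchange x (x ⁻¹) _ _ ⟩
    (x ∙ m ∗ x) ∙ (x ⁻¹ ∙ (n ∗ x) ⁻¹)       ≈⟨ ∙-congˡ (⁻¹-∙-comm _ _) ⟩
    suc m ∗ x ∙ (suc n ∗ x) ⁻¹              ∎

  ·-homo-+ : ∀ x i j → (i ℤ.+ j) · x ≈ i · x ∙ j · x
  ·-homo-+ x (+ m)    (+ n)    = ×-homo-+ x m n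
  ·-homo-+ x (+ m)    -[1+ n ] = ·-⊖ m (suc n) x
  ·-homo-+ x -[1+ m ] (+ n)    = trans (·-⊖ n (suc m) x) (comm _ _)
  ·-homo-+ x -[1+ m ] -[1+ n ] = begin
    (suc (suc (m ℕ.+ n)) ∗ x) ⁻¹          ≡⟨ ≡.cong (λ k → (suc k ∗ x) ⁻¹) (ℕ.+-suc m n) ⟨
    ((suc m ℕ.+ suc n) ∗ x) ⁻¹            ≈⟨ ⁻¹-cong (×-homo-+ x (suc m) (suc n)) ⟩
    (suc m ∗ x ∙ suc n ∗ x) ⁻¹            ≈⟨ ⁻¹-∙-comm _ _ ⟨
    (suc m ∗ x) ⁻¹ ∙ (suc n ∗ x) ⁻¹       ∎

  orbit-hom : ∀ x → IsGroupHomomorphism (AbelianGroup.rawGroup +-0-abelianGroup) rawGroup (_· x)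
  orbit-hom x = mkHom +-0-abelianGroup G (_· x) (λ i≡j → reflexive (≡.cong (_· x) i≡j)) (·-homo-+ x)

  ·-neg : ∀ i x → (ℤ.- i) · x ≈ (i · x) ⁻¹
  ·-neg i x = IsGroupHomomorphism.⁻¹-homo (orbit-hom x) i

  ·-assoc-× : ∀ i n x → (i ℤ.* + n) · x ≈ i · (n ∗ x)
  ·-assoc-× i zero    x = trans (reflexive (≡.cong (_· x) (ℤ.*-zeroʳ i)))
    (sym (IsGroupHomomorphism.ε-homo (·-hom i)))
  ·-assoc-× i (suc n) x = begin
    (i ℤ.* (+ 1 ℤ.+ + n)) · x          ≡⟨ ≡.cong (_· x) (ℤ.*-distribˡ-+ i (+ 1) (+ n)) ⟩
    (i ℤ.* + 1 ℤ.+ i ℤ.* + n) · x      ≡⟨ ≡.cong (λ k → (k ℤ.+ i ℤ.* + n) · x) (ℤ.*-identityʳ i) ⟩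
    (i ℤ.+ i ℤ.* + n) · x              ≈⟨ ·-homo-+ x i (i ℤ.* + n) ⟩
    i · x ∙ (i ℤ.* + n) · x            ≈⟨ ∙-congˡ (·-assoc-× i n x) ⟩
    i · x ∙ i · (n ∗ x)                ≈⟨ ·-distribʳ i x (n ∗ x) ⟨
    i · (suc n ∗ x)                    ∎

module _ (A : AbelianGroup a b) (B : AbelianGroup c d) where
  private
    module A where
      open AbelianGroup A public
      open ℤ-Action A public
    module B where
      open AbelianGroup B public
      open ℤ-Action B public

  hom-× : ∀ {f} → IsGroupHomomorphism A.rawGroup B.rawGroup f →
          ∀ n x → f (n A.∗ x) B.≈ n B.∗ f x
  hom-× f-hom zero    x = IsGroupHomomorphism.ε-homo f-hom
  hom-× f-hom (suc n) x =
    B.trans (IsGroupHomomorphism.homo f-hom _ _) (B.∙-congˡ (hom-× f-hom n x))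

  hom-· : ∀ {f} → IsGroupHomomorphism A.rawGroup B.rawGroup f →
          ∀ i x → f (i A.· x) B.≈ i B.· f x
  hom-· f-hom (+ n)    x = hom-× f-hom n x
  hom-· f-hom -[1+ n ] x =
    B.trans (IsGroupHomomorphism.⁻¹-homo f-hom _) (B.⁻¹-cong (hom-× f-hom (suc n) x))

-- Formal group terms and their evaluation.

infixl 6 _⊕_
infix  8 ⊝_

data Term (A : Set a) : Set a where
  var : A → Term A
  𝟘   : Term A
  _⊕_ : Term A → Term A → Term A
  ⊝_  : Term A → Term A

All : {A : Set a} → Pred A p → Pred (Term A) p
All P (var x)  = P x
All P 𝟘        = ⊤
All P (s ⊕ t)  = All P s × All P t
All P (⊝ t)    = All P t

all-map : {A : Set a} {P : Pred A p} {Q : Pred A q} → (∀ {x} → P x → Q x) →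
          ∀ t → All P t → All Q t
all-map P⇒Q (var x) px        = P⇒Q px
all-map P⇒Q 𝟘       _         = _
all-map P⇒Q (s ⊕ t) (ps , pt) = all-map P⇒Q s ps , all-map P⇒Q t pt
all-map P⇒Q (⊝ t)   pt        = all-map P⇒Q t pt

all : {A : Set a} {P : Pred A p} → (∀ x → P x) → ∀ t → All P t
all p (var x) = p x
all p 𝟘       = _
all p (s ⊕ t) = all p s , all p t
all p (⊝ t)   = all p t

fold : {A : Set a} (G : AbelianGroup c d) → (A → AbelianGroup.Carrier G) →
       Term A → AbelianGroup.Carrier G
fold {A = A} G f = go
  where
  open AbelianGroup G
  go : Term A → Carrier
  go (var x) = f x
  go 𝟘       = ε
  go (s ⊕ t) = go s ∙ go t
  go (⊝ t)   = go t ⁻¹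

module _ {A : Set a} (G : AbelianGroup c d) where
  private module G = AbelianGroup G

  fold-hom : (H : AbelianGroup p q) → let module H = AbelianGroup H in
             ∀ {φ f g} → IsGroupHomomorphism G.rawGroup H.rawGroup φ →
             (t : Term A) → All (λ x → φ (f x) H.≈ g x) t → φ (fold G f t) H.≈ fold H g t
  fold-hom H φ-hom (var x) p       = p
  fold-hom H φ-hom 𝟘       _       = IsGroupHomomorphism.ε-homo φ-hom
  fold-hom H φ-hom (s ⊕ t) (p , q) = H.trans (IsGroupHomomorphism.homo φ-hom _ _)
    (H.∙-cong (fold-hom H φ-hom s p) (fold-hom H φ-hom t q))
    where module H = AbelianGroup H
  fold-hom H φ-hom (⊝ t)   p       = H.trans (IsGroupHomomorphism.⁻¹-homo φ-hom _)
    (H.⁻¹-cong (fold-hom H φ-hom t p))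
    where module H = AbelianGroup H

  fold-ε : ∀ {f} (t : Term A) → All (λ x → f x G.≈ G.ε) t → fold G f t G.≈ G.ε
  fold-ε {f} t f≈ε = G.sym (fold-hom G {φ = λ _ → G.ε} {f = f}
    (mkHom G G _ (λ _ → G.refl) λ _ _ → G.sym (G.identityˡ G.ε)) t (all-map G.sym t f≈ε))

  fold-∙ : ∀ {f g h} (t : Term A) → All (λ x → h x G.≈ f x G.∙ g x) t →
           fold G h t G.≈ fold G f t G.∙ fold G g t
  fold-∙ (var x) p       = p
  fold-∙ 𝟘       _       = G.sym (G.identityˡ G.ε)
  fold-∙ (s ⊕ t) (p , q) = G.trans (G.∙-cong (fold-∙ s p) (fold-∙ t q)) (interchange _ _ _ _)
    where open ℤ-Action G
  fold-∙ (⊝ t)   p       = G.trans (G.⁻¹-cong (fold-∙ t p)) (G.sym (⁻¹-∙-comm _ _))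
    where open ℤ-Action G

-- The quotient of the terms by the kernel of `F`, realised by pulling equality back along `F`; the
-- group laws are inherited because `F` becomes injective.
TermGroup : (A : Set a) (G : AbelianGroup c d) → let module G = AbelianGroup G in
            (F : Term A → G.Carrier) → F 𝟘 G.≈ G.ε → (∀ s t → F (s ⊕ t) G.≈ F s G.∙ F t) →
            (∀ t → F (⊝ t) G.≈ F t G.⁻¹) → AbelianGroup a d
TermGroup A G F F-𝟘 F-⊕ F-⊝ = record
  { isAbelianGroup = GroupMonomorphism.isAbelianGroup F-isMonomorphism G.isAbelianGroup }
  where
  module G = AbelianGroup G
  terms : RawGroup _ _
  terms = record { Carrier = Term A ; _≈_ = G._≈_ on F ; _∙_ = _⊕_ ; ε = 𝟘 ; _⁻¹ = ⊝_ }
  F-isMonomorphism : IsGroupMonomorphism terms G.rawGroup F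
  F-isMonomorphism = record
    { isGroupHomomorphism = record
      { isMonoidHomomorphism = record
        { isMagmaHomomorphism = record { isRelHomomorphism = record { cong = id } ; homo = F-⊕ }
        ; ε-homo              = F-𝟘
        }
      ; ⁻¹-homo = F-⊝
      }
    ; injective = id
    }

-- Integer-valued functions detect the vanishing of group-valued pairings.

module Separation (em : ExcludedMiddle ℓ) (S : Setoid ℓ ℓ) (X : AbelianGroup ℓ ℓ)
                  {A : Set ℓ} (coeff : A → ℕ) (point : A → Setoid.Carrier S) where
  private
    module S = Setoid S
    module X where
      open AbelianGroup X public
      open ℤ-Action X public
    ℤ-setoid = ≡.setoid ℤ

  -- A term is read as a formal integer combination of points of `S`, each generator `x` standing
  -- for `coeff x` copies of `point x`, and `q` is extended linearly.
  pairing : (Func S X.setoid) → Term A → X.Carrier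
  pairing q = fold X λ x → coeff x X.∗ (q ⟨$⟩ point x)

  ℤ-pairing : (Func S ℤ-setoid) → Term A → ℤ
  ℤ-pairing u = fold +-0-abelianGroup λ x → + coeff x ℤ.* (u ⟨$⟩ point x)

  indicator : S.Carrier → Func S ℤ-setoid
  indicator s = record
    { to   = λ t → value (em {t S.≈ s})
    ; cong = λ {t} {t′} t≈t′ → value-cong em em t≈t′
    }
    where
    value : {B : Set ℓ} → Dec B → ℤ
    value (yes _) = + 1
    value (no  _) = + 0
    value-cong : ∀ {t t′} (d : Dec (t S.≈ s)) (d′ : Dec (t′ S.≈ s)) → t S.≈ t′ → value d ≡ value d′
    value-cong (yes _)   (yes _)   _    = ≡.refl
    value-cong (yes t≈s) (no t′≉s) t≈t′ = contradiction (S.trans (S.sym t≈t′) t≈s) t′≉s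
    value-cong (no t≉s)  (yes t′≈s) t≈t′ = contradiction (S.trans t≈t′ t′≈s) t≉s
    value-cong (no _)    (no _)    _    = ≡.refl

  spike : S.Carrier → X.Carrier → Func S X.setoid
  spike s x = record
    { to   = λ t → (indicator s ⟨$⟩ t) X.· x
    ; cong = λ t≈t′ → X.reflexive (≡.cong (X._· x) (Func.cong (indicator s) t≈t′))
    }

  -- The homomorphism `_· x` from ℤ to `X` carries the integer pairing with the indicator to the
  -- pairing with the spike, summand by summand.
  pairing-spike : ∀ s x e → pairing (spike s x) e X.≈ ℤ-pairing (indicator s) e X.· x
  pairing-spike s x e = X.sym (fold-hom +-0-abelianGroup X (X.orbit-hom x) e (all (λ y →
    X.trans (X.reflexive (≡.cong (X._· x) (ℤ.*-comm (+ coeff y) _)))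
      (X.trans (X.·-assoc-× (indicator s ⟨$⟩ point y) (coeff y) x)
        (X.sym (hom-· X X (X.·-hom (+ coeff y)) (indicator s ⟨$⟩ point y) x)))) e))

  points : Term A → List S.Carrier
  points (var x) = point x ∷ []
  points 𝟘       = []
  points (s ⊕ t) = points s ++ points t
  points (⊝ t)   = points t

  module _ (e : Term A) (e⊥ : ∀ u → ℤ-pairing u e ≡ + 0) where

    -- Induction on a list outside which `q` is zero on the points of `e`. Subtracting the spike of
    -- height `q s` at `s` removes `s` from the list; the pairing with that spike is an integer
    -- multiple of `q s` whose coefficient is zero by `e⊥`.
    vanish : ∀ ss (q : Func S X.setoid) →
             All (λ x → ¬ Any (point x S.≈_) ss → q ⟨$⟩ point x X.≈ X.ε) e →
             pairing q e X.≈ X.ε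
    vanish [] q q≈ε = fold-ε X e (all-map (λ {x} p → X.trans (X.×-congʳ (coeff x) (p λ ()))
      (IsGroupHomomorphism.ε-homo (X.·-hom (+ coeff x)))) e q≈ε)
    vanish (s ∷ ss) q q≈ε = X.trans
      (fold-∙ X e (all (λ x → X.trans (X.×-congʳ (coeff x) (X.sym (X.//-rightDividesˡ _ _)))
        (X.×-distrib-+ _ _ (coeff x))) e))
      (X.trans (X.∙-cong (vanish ss q′ (all-map q′≈ε e q≈ε))
        (X.trans (pairing-spike s qs e) (X.reflexive (≡.cong (X._· qs) (e⊥ (indicator s))))))
        (X.identityˡ X.ε))
      where
      qs = q ⟨$⟩ s
      q′ : Func S X.setoid
      q′ = record
        { to   = λ t → (q ⟨$⟩ t) X.∙ (spike s qs ⟨$⟩ t) X.⁻¹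
        ; cong = λ t≈t′ → X.∙-cong (Func.cong q t≈t′) (X.⁻¹-cong (Func.cong (spike s qs) t≈t′))
        }
      q′≈ε : ∀ {x} → (¬ Any (point x S.≈_) (s ∷ ss) → q ⟨$⟩ point x X.≈ X.ε) →
             ¬ Any (point x S.≈_) ss → q′ ⟨$⟩ point x X.≈ X.ε
      q′≈ε {x} qx≈ε x∉ss with em {point x S.≈ s}
      ... | yes x≈s = X.trans (X.∙-cong (Func.cong q x≈s)
        (X.⁻¹-cong (X.×-homo-1 _))) (X.inverseʳ qs)
      ... | no x≉s = X.trans (X.∙-cong (qx≈ε λ { (here x≈s) → x≉s x≈s ; (there x∈ss) → x∉ss x∈ss })
        X.ε⁻¹≈ε) (X.identityˡ X.ε)

    in-points : ∀ t → All (λ x → Any (point x S.≈_) (points t)) t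
    in-points (var x) = here S.refl
    in-points 𝟘       = _
    in-points (s ⊕ t) = all-map ++⁺ˡ s (in-points s) , all-map (++⁺ʳ (points s)) t (in-points t)
    in-points (⊝ t)   = in-points t

    -- Only finitely many points occur in `e`; outside the list of all of them there is nothing to
    -- check.
    pairing≈ε : ∀ q → pairing q e X.≈ X.ε
    pairing≈ε q = vanish (points e) q
      (all-map (λ x∈ x∉ → contradiction x∈ x∉) e (in-points e))

-- The coefficients k! / n!.

δ : ℕ → ℕ → ℕ
δ n k = if n ℕ.≡ᵇ k then 1 else 0

δ-diag : ∀ n → δ n n ≡ 1
δ-diag zero    = ≡.refl
δ-diag (suc n) = δ-diag n

δ-off : ∀ {n k} → ¬ n ≡ k → δ n k ≡ 0
δ-off {zero}  {zero}  n≢k = contradiction ≡.refl n≢k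
δ-off {zero}  {suc k} n≢k = ≡.refl
δ-off {suc n} {zero}  n≢k = ≡.refl
δ-off {suc n} {suc k} n≢k = δ-off (n≢k ∘ ≡.cong suc)

δ-swap : ∀ n k → δ n k ℕ.* suc k ≡ suc n ℕ.* δ n k
δ-swap n k with n ℕ.≟ k
... | yes ≡.refl = ℕ.*-comm (δ n n) (suc n)
... | no n≢k rewrite δ-off n≢k = ≡.sym (ℕ.*-zeroʳ (suc n))

-- k! / n! for n ≤ k, and 0 for n > k.

ratio : ℕ → ℕ → ℕ
ratio n zero    = δ n 0
ratio n (suc k) = ratio n k ℕ.* suc k ℕ.+ δ n (suc k)

ratio-suc : ∀ {n k} → n ℕ.≤ k → ratio n (suc k) ≡ ratio n k ℕ.* suc k
ratio-suc {n} {k} n≤k = ≡.trans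
  (≡.cong (λ i → ratio n k ℕ.* suc k ℕ.+ i) (δ-off (ℕ.<⇒≢ (ℕ.s≤s n≤k)))) (ℕ.+-identityʳ _)

-- The definition recurses in `k`, while the relation between y(h,n) and y(h,n+1) needs recursion in
-- `n`; `δ n k` is the coefficient of the node [h|n].
ratio-unfold : ∀ n k → ratio n k ≡ suc n ℕ.* ratio (suc n) k ℕ.+ δ n k
ratio-unfold n zero    = ≡.cong (ℕ._+ δ n 0) (≡.sym (ℕ.*-zeroʳ (suc n)))
ratio-unfold n (suc k) = ≡.cong (ℕ._+ δ n (suc k)) (begin
  ratio n k ℕ.* suc k
    ≡⟨ ≡.cong (ℕ._* suc k) (ratio-unfold n k) ⟩
  (suc n ℕ.* ratio (suc n) k ℕ.+ δ n k) ℕ.* suc k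
    ≡⟨ ℕ.*-distribʳ-+ (suc k) (suc n ℕ.* ratio (suc n) k) (δ n k) ⟩
  suc n ℕ.* ratio (suc n) k ℕ.* suc k ℕ.+ δ n k ℕ.* suc k
    ≡⟨ ≡.cong₂ ℕ._+_ (ℕ.*-assoc (suc n) (ratio (suc n) k) (suc k)) (δ-swap n k) ⟩
  suc n ℕ.* (ratio (suc n) k ℕ.* suc k) ℕ.+ suc n ℕ.* δ n k
    ≡⟨ ℕ.*-distribˡ-+ (suc n) (ratio (suc n) k ℕ.* suc k) (δ n k) ⟨
  suc n ℕ.* (ratio (suc n) k ℕ.* suc k ℕ.+ δ n k)
    ∎)
  where open ≡.≡-Reasoning

-- Solvable groups and germs of sequences.

Solvable : Pred (AbelianGroup a b) _
Solvable X = ∀ (p : ℕ → Carrier) → ∃ λ (z : ℕ → Carrier) → ∀ n → z n ≈ p n ∙ suc n ∗ z (suc n)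
  where
  open AbelianGroup X
  open ℤ-Action X

Eventually : Pred (Pred ℕ p) p
Eventually P = ∃ λ N → ∀ j → N ℕ.≤ j → P j

-- Sequences modulo eventual equality replace limits of partial sums, which need not exist in `X`;
-- constant sequences embed `X`.
Germs : AbelianGroup a b → AbelianGroup a b
Germs X = record
  { Carrier        = ℕ → Carrier
  ; _≈_            = λ f g → Eventually λ j → f j ≈ g j
  ; _∙_            = λ f g j → f j ∙ g j
  ; ε              = λ _ → ε
  ; _⁻¹            = λ f j → f j ⁻¹
  ; isAbelianGroup = record
    { isGroup = record
      { isMonoid = record
        { isSemigroup = record
          { isMagma = record
            { isEquivalence = record
              { refl  = always λ _ → refl
              ; sym   = λ (N , f≈g) → N , λ j N≤j → sym (f≈g j N≤j)
              ; trans = both trans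
              }
            ; ∙-cong = both ∙-cong
            }
          ; assoc = λ f g h → always λ j → assoc (f j) (g j) (h j)
          }
        ; identity = (λ f → always λ j → identityˡ (f j)) , λ f → always λ j → identityʳ (f j)
        }
      ; inverse = (λ f → always λ j → inverseˡ (f j)) , λ f → always λ j → inverseʳ (f j)
      ; ⁻¹-cong = λ (N , f≈g) → N , λ j N≤j → ⁻¹-cong (f≈g j N≤j)
      }
    ; comm = λ f g → always λ j → comm (f j) (g j)
    }
  }
  where
  open AbelianGroup X
  always : {P : Pred ℕ p} → (∀ j → P j) → Eventually P
  always P = 0 , λ j _ → P j
  both : {P : Pred ℕ p} {Q : Pred ℕ q} {R : Pred ℕ d} → (∀ {j} → P j → Q j → R j) →
         Eventually P → Eventually Q → Eventually R
  both PQ⇒R (M , P) (N , Q) = M ℕ.⊔ N , λ j M⊔N≤j →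
    PQ⇒R (P j (ℕ.m⊔n≤o⇒m≤o M N M⊔N≤j)) (Q j (ℕ.m⊔n≤o⇒n≤o M N M⊔N≤j))

-- The tree of nodes and the group generated by its nodes and branches.

module Tree (X : AbelianGroup ℓ ℓ) where
  private
    module X where
      open AbelianGroup X public
      open ℤ-Action X public
    ℤ-setoid = ≡.setoid ℤ

  -- A node of level n is the restriction of a branch to the levels below n.

  Node : ℕ → Setoid ℓ ℓ
  Node zero    = ≡.setoid ⊤
  Node (suc n) = ×-setoid (Node n) (Node n ⇨ X.setoid)

  Branch : Set ℓ
  Branch = ∀ n → Func (Node n) X.setoid

  trunc : Branch → ∀ n → Setoid.Carrier (Node n)
  trunc h zero    = _
  trunc h (suc n) = trunc h n , h n

  -- The same generators serve the base group and its extension, so that the projection is the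
  -- identity on terms; `element` supplies the copy of `X` in the extension.
  data Gen : Set ℓ where
    element : X.Carrier → Gen
    node    : ∀ n → Setoid.Carrier (Node n) → Gen
    branch  : Branch → ℕ → Gen

  Test : Set ℓ
  Test = Σ[ k ∈ ℕ ] Func (Node k) ℤ-setoid

  at-node : ∀ {n k} → Dec (n ≡ k) → Func (Node k) ℤ-setoid → Setoid.Carrier (Node n) → ℤ
  at-node (yes ≡.refl) u t = u ⟨$⟩ t
  at-node (no  _)      u t = + 0

  -- branch h n stands for y(h,n), evaluated as the formal sum of (k! / n!) [h|k]
  -- over k ≥ n; elements of X vanish in the base group.

  evalGen : Test → Gen → ℤ
  evalGen (k , u) (element x)  = + 0
  evalGen (k , u) (node n t)   = at-node (n ℕ.≟ k) u t
  evalGen (k , u) (branch h n) = + ratio n k ℤ.* (u ⟨$⟩ trunc h k)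

  eval : Test → Term Gen → ℤ
  eval i = fold +-0-abelianGroup (evalGen i)

  eval-trunc : ∀ h n k u → evalGen (k , u) (node n (trunc h n)) ≡ + δ n k ℤ.* (u ⟨$⟩ trunc h k)
  eval-trunc h n k u with n ℕ.≟ k
  ... | yes ≡.refl rewrite δ-diag n = ≡.sym (ℤ.*-identityˡ _)
  ... | no n≢k rewrite δ-off n≢k = ≡.sym (ℤ.*-zeroˡ (u ⟨$⟩ trunc h k))

  eval-unfold : ∀ i h n → evalGen i (branch h n) ≡
                + suc n ℤ.* evalGen i (branch h (suc n)) ℤ.+ evalGen i (node n (trunc h n))
  eval-unfold (k , u) h n = begin
    + ratio n k ℤ.* v
      ≡⟨ ≡.cong (λ r → + r ℤ.* v) (ratio-unfold n k) ⟩
    (+ (suc n ℕ.* ratio (suc n) k) ℤ.+ + δ n k) ℤ.* v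
      ≡⟨ ℤ.*-distribʳ-+ v (+ (suc n ℕ.* ratio (suc n) k)) (+ δ n k) ⟩
    + (suc n ℕ.* ratio (suc n) k) ℤ.* v ℤ.+ + δ n k ℤ.* v
      ≡⟨ ≡.cong₂ ℤ._+_ (≡.trans (≡.cong (ℤ._* v) (ℤ.pos-* (suc n) (ratio (suc n) k)))
           (ℤ.*-assoc (+ suc n) (+ ratio (suc n) k) v)) (≡.sym (eval-trunc h n k u)) ⟩
    + suc n ℤ.* (+ ratio (suc n) k ℤ.* v) ℤ.+ evalGen (k , u) (node n (trunc h n))
      ∎
    where
    open ≡.≡-Reasoning
    v = u ⟨$⟩ trunc h k

  ℤ^Test : AbelianGroup ℓ ℓ
  ℤ^Test = Pointwise.abelianGroup Test +-0-abelianGroup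

  -- Two terms are identified when no test separates them, so the embedding into a power of ℤ holds
  -- by construction.
  base-group : AbelianGroup ℓ ℓ
  base-group = TermGroup Gen ℤ^Test (λ e i → eval i e)
    (λ _ → ≡.refl) (λ _ _ _ → ≡.refl) (λ _ _ → ≡.refl)

  eval-hom : ∀ i → IsGroupHomomorphism (AbelianGroup.rawGroup base-group)
                     (AbelianGroup.rawGroup +-0-abelianGroup) (eval i)
  eval-hom i = mkHom base-group +-0-abelianGroup (eval i) (λ s≈t → s≈t i) λ _ _ → ≡.refl

  Below : ℕ → Gen → Set
  Below j (element x)  = ⊤
  Below j (node n t)   = n ℕ.≤ j
  Below j (branch h n) = n ℕ.≤ j

  genBound : Gen → ℕ
  genBound (element x)  = 0
  genBound (node n t)   = n
  genBound (branch h n) = n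

  bound : Term Gen → ℕ
  bound (var g) = genBound g
  bound 𝟘       = 0
  bound (s ⊕ t) = bound s ℕ.⊔ bound t
  bound (⊝ t)   = bound t

  below-bound : ∀ {j} t → bound t ℕ.≤ j → All (Below j) t
  below-bound (var (element x))  _   = _
  below-bound (var (node n t))   n≤j = n≤j
  below-bound (var (branch h n)) n≤j = n≤j
  below-bound 𝟘                  _   = _
  below-bound (s ⊕ t) b≤j = below-bound s (ℕ.m⊔n≤o⇒m≤o (bound s) (bound t) b≤j) ,
                            below-bound t (ℕ.m⊔n≤o⇒n≤o (bound s) (bound t) b≤j)
  below-bound (⊝ t)   b≤j = below-bound t b≤j

  coeff : ℕ → Gen → ℕ
  coeff j (element x)  = 0
  coeff j (node n t)   = 0
  coeff j (branch h n) = ratio n j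

  point : ∀ j → Gen → Setoid.Carrier (Node j)
  point j (branch h n) = trunc h j
  -- A default: these generators have coefficient zero, so any node will do, here a truncation of
  -- the zero branch.
  point j _            = trunc (λ n → record { to = λ _ → X.ε ; cong = λ _ → X.refl }) j

  -- The extension of the base group twisted by a cocycle.

  module Twisted (em : ExcludedMiddle ℓ) (cocycle : ∀ j → Func (Node (suc j)) X.setoid) where

    module AtLevel (j : ℕ) = Separation em (Node (suc j)) X (coeff j) (point (suc j))

    -- Level `suc n` is the first at which the node records both h|n and the function `h n`, hence
    -- the value h(h|n).
    twist : Branch → ℕ → X.Carrier
    twist h n = cocycle n ⟨$⟩ trunc h (suc n)

    -- The formal series with terms `ratio n i` times `twist h i`, cut off before `j`: the
    -- contribution of the twists to y(h,n).
    partialSum : Branch → ℕ → ℕ → X.Carrier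
    partialSum h n zero    = X.ε
    partialSum h n (suc j) = partialSum h n j X.∙ ratio n j X.∗ twist h j

    valueGen : ℕ → Gen → X.Carrier
    valueGen j (element x)  = x
    valueGen j (node n t)   = X.ε
    valueGen j (branch h n) = partialSum h n j

    value : ℕ → Term Gen → X.Carrier
    value j = fold X (valueGen j)

    -- `unfold` holds at every `j` with the partial sum `diag` of the terms `δ n i X.∗ twist h i` in
    -- place of the twist; `diag` becomes `twist h n` as soon as `j` exceeds `n`.
    partialSum-unfold : ∀ h n → Eventually λ j →
      partialSum h n j X.≈ suc n X.∗ partialSum h (suc n) j X.∙ twist h n
    partialSum-unfold h n = suc n , λ j n<j → X.trans (unfold j) (X.∙-congˡ (diagonal n<j))
      where
      open ≈-Reasoning X.setoid
      diag : ℕ → X.Carrier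
      diag zero    = X.ε
      diag (suc j) = diag j X.∙ δ n j X.∗ twist h j
      unfold : ∀ j → partialSum h n j X.≈ suc n X.∗ partialSum h (suc n) j X.∙ diag j
      unfold zero    = X.sym (X.trans (X.identityʳ _)
        (IsGroupHomomorphism.ε-homo (X.·-hom (+ suc n))))
      unfold (suc j) = begin
        partialSum h n j X.∙ ratio n j X.∗ twist h j
          ≈⟨ X.∙-cong (unfold j) (X.trans (X.×-congˡ (ratio-unfold n j))
               (X.trans (X.×-homo-+ (twist h j) (suc n ℕ.* ratio (suc n) j) (δ n j))
                 (X.∙-congʳ (X.sym (X.×-assocˡ (twist h j) (suc n) (ratio (suc n) j)))))) ⟩
        (suc n X.∗ s X.∙ diag j) X.∙ (suc n X.∗ r X.∙ δ n j X.∗ twist h j)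
          ≈⟨ X.interchange _ _ _ _ ⟩
        (suc n X.∗ s X.∙ suc n X.∗ r) X.∙ diag (suc j)
          ≈⟨ X.∙-congʳ (X.×-distrib-+ s r (suc n)) ⟨
        suc n X.∗ (s X.∙ r) X.∙ diag (suc j)
          ∎
        where
        s = partialSum h (suc n) j
        r = ratio (suc n) j X.∗ twist h j
      off : ∀ j {k} → ¬ n ≡ j → k X.≈ X.ε X.∙ δ n j X.∗ twist h j → k X.≈ X.ε
      off j n≢j k≈ = X.trans k≈ (X.trans (X.identityˡ _) (X.×-congˡ (δ-off n≢j)))
      before : ∀ {j} → j ℕ.≤ n → diag j X.≈ X.ε
      before {zero}  _   = X.refl
      before {suc j} j<n = off j (λ n≡j → ℕ.<⇒≢ j<n (≡.sym n≡j)) (X.∙-congʳ (before (ℕ.<⇒≤ j<n)))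
      diagonal : ∀ {j} → n ℕ.< j → diag j X.≈ twist h n
      diagonal {suc j} (ℕ.s≤s n≤j) with n ℕ.≟ j
      ... | yes ≡.refl = X.trans (X.∙-cong (before ℕ.≤-refl) (X.×-congˡ (δ-diag n)))
                           (X.trans (X.identityˡ _) (X.×-homo-1 _))
      ... | no n≢j = X.trans (X.∙-cong (diagonal (ℕ.≤∧≢⇒< n≤j n≢j)) (X.×-congˡ (δ-off n≢j)))
                       (X.identityʳ _)

    -- The increment of the value is a pairing with the nodes of level j + 1, as the
    -- twist of branch h at j depends only on h|(j+1).  If all tests vanish on e, so does
    -- this pairing for large j: the value of e is then eventually constant.

    value-suc : ∀ j e → value (suc j) e X.≈ value j e X.∙ AtLevel.pairing j (cocycle j) e
    value-suc j e = fold-∙ X e (all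
      (λ { (element x)  → X.sym (X.identityʳ x)
         ; (node n t)   → X.sym (X.identityʳ X.ε)
         ; (branch h n) → X.refl }) e)

    -- When `j` is at least every level in `e`, no node of `e` reaches level `suc j`, and each
    -- `ratio n (suc j)` is `suc j` times `ratio n j`. Cancelling this factor turns vanishing tests
    -- into vanishing pairings.
    eval-suc : ∀ j u e → All (Below j) e → eval (suc j , u) e ≡ + suc j ℤ.* AtLevel.ℤ-pairing j u e
    eval-suc j u e below = ≡.sym (fold-hom +-0-abelianGroup +-0-abelianGroup
      (mkHom +-0-abelianGroup +-0-abelianGroup (+ suc j ℤ.*_) (≡.cong (+ suc j ℤ.*_))
        (ℤ.*-distribˡ-+ (+ suc j))) e (all-map (λ {g} → gen g) e below))
      where
      zeros : ∀ i → + suc j ℤ.* (+ 0 ℤ.* i) ≡ + 0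
      zeros i = ≡.trans (≡.cong (+ suc j ℤ.*_) (ℤ.*-zeroˡ i)) (ℤ.*-zeroʳ (+ suc j))
      gen : ∀ g → Below j g →
            + suc j ℤ.* (+ coeff j g ℤ.* (u ⟨$⟩ point (suc j) g)) ≡ evalGen (suc j , u) g
      gen (element x)  _   = zeros (u ⟨$⟩ point (suc j) (element x))
      gen (node n t)   n≤j with n ℕ.≟ suc j
      ... | yes ≡.refl = contradiction n≤j ℕ.1+n≰n
      ... | no  _      = zeros (u ⟨$⟩ point (suc j) (node n t))
      gen (branch h n) n≤j = begin
        + suc j ℤ.* (+ ratio n j ℤ.* v)
          ≡⟨ ℤ.*-assoc (+ suc j) (+ ratio n j) v ⟨
        + suc j ℤ.* + ratio n j ℤ.* v
          ≡⟨ ≡.cong (ℤ._* v) (ℤ.pos-* (suc j) (ratio n j)) ⟨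
        + (suc j ℕ.* ratio n j) ℤ.* v
          ≡⟨ ≡.cong (λ r → + r ℤ.* v) (≡.trans (ℕ.*-comm (suc j) (ratio n j)) (≡.sym (ratio-suc n≤j))) ⟩
        + ratio n (suc j) ℤ.* v
          ∎
        where
        open ≡.≡-Reasoning
        v = u ⟨$⟩ trunc h (suc j)

    value-stable : ∀ e → (∀ i → eval i e ≡ + 0) → ∀ {j} → bound e ℕ.≤ j →
                   value (suc j) e X.≈ value j e
    value-stable e e⊥ {j} b≤j = X.trans (value-suc j e) (X.trans
      (X.∙-congˡ (AtLevel.pairing≈ε j e pairing≡0 (cocycle j))) (X.identityʳ _))
      where
      pairing≡0 : ∀ u → AtLevel.ℤ-pairing j u e ≡ + 0
      pairing≡0 u = ℤ.*-cancelˡ-≡ (+ suc j) _ (+ 0) (≡.trans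
        (≡.sym (eval-suc j u e (below-bound e b≤j)))
        (≡.trans (e⊥ (suc j , u)) (≡.sym (ℤ.*-zeroʳ (+ suc j)))))

    value-eventual : ∀ e → (∀ i → eval i e ≡ + 0) → ∀ {j} → bound e ℕ.≤′ j →
                     value (bound e) e X.≈ value j e
    value-eventual e e⊥ ℕ.≤′-refl       = X.refl
    value-eventual e e⊥ (ℕ.≤′-step b≤j) =
      X.trans (value-eventual e e⊥ b≤j) (X.sym (value-stable e e⊥ (ℕ.≤′⇒≤ b≤j)))

    -- Equality demands agreement of the germs of values besides agreement under all tests, so it
    -- refines the equality of the base group.
    total-group : AbelianGroup ℓ ℓ
    total-group = TermGroup Gen (DirectProduct.abelianGroup ℤ^Test (Germs X))
      (λ e → (λ i → eval i e) , λ j → value j e)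
      E.refl (λ _ _ → E.refl) (λ _ → E.refl)
      where module E = AbelianGroup (DirectProduct.abelianGroup ℤ^Test (Germs X))

    private
      module E where
        open AbelianGroup total-group public
        open ℤ-Action total-group public

    twisted : Extension base-group X
    twisted = record
      { E = total-group
      ; ι = var ∘ element
      ; π = id
      ; ι-isMonomorphism = record
        { isGroupHomomorphism = mkHom X total-group (var ∘ element)
            (λ x≈y → (λ _ → ≡.refl) , 0 , λ _ _ → x≈y)
            (λ x y → (λ _ → ≡.refl) , 0 , λ _ _ → X.refl)
        ; injective = λ (_ , N , x≈y) → x≈y N ℕ.≤-refl
        }
      ; π-isHomomorphism = mkHom total-group base-group id proj₁ (λ _ _ _ → ≡.refl)
      ; π-surjective = λ e → e , proj₁
      -- The value of a term killed by all tests is constant from `bound e` on; that constant is its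
      -- preimage in `X`.
      ; exact = λ e → mk⇔
          (λ e⊥ → value (bound e) e , (λ i → ≡.sym (e⊥ i)) ,
             bound e , λ j b≤j → value-eventual e e⊥ (ℕ.≤⇒≤′ b≤j))
          (λ (x , ex≈e , _) i → ≡.sym (ex≈e i))
      }

    eval-∗ : ∀ i n e → eval i (n E.∗ e) ≡ + n ℤ.* eval i e
    eval-∗ i zero    e = ≡.sym (ℤ.*-zeroˡ (eval i e))
    eval-∗ i (suc n) e = ≡.trans (≡.cong (λ k → eval i e ℤ.+ k) (eval-∗ i n e)) (≡.sym (ℤ.suc-* (+ n) (eval i e)))

    value-∗ : ∀ j n e → value j (n E.∗ e) X.≈ n X.∗ value j e
    value-∗ j zero    e = X.refl
    value-∗ j (suc n) e = X.∙-congˡ (value-∗ j n e)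

    -- The tests see only the node and the germ sees only the twist; together they give the twisted
    -- relation.
    branch-unfold : ∀ h n → var (branch h n) E.≈
      suc n E.∗ var (branch h (suc n)) E.∙ (var (node n (trunc h n)) E.∙ var (element (twist h n)))
    branch-unfold h n =
      (λ i → ≡.trans (eval-unfold i h n) (≡.cong₂ ℤ._+_
        (≡.sym (eval-∗ i (suc n) (var (branch h (suc n)))))
        (≡.sym (ℤ.+-identityʳ (evalGen i (node n (trunc h n))))))) ,
      proj₁ (partialSum-unfold h n) , λ j N≤j → X.trans (proj₂ (partialSum-unfold h n) j N≤j)
        (X.∙-cong (X.sym (value-∗ j (suc n) _)) (X.sym (X.identityˡ _)))

  -- A retraction ρ : E → X of the twisted extension yields the branch t ↦ ρ [t];
  -- along that very branch the cocycle below cancels the node terms.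

  ext≡0⇒solvable : ExcludedMiddle ℓ → Ext≡0 base-group X → Solvable X
  ext≡0⇒solvable em split p = z , z-unfold
    where
    cocycle : ∀ j → Func (Node (suc j)) X.setoid
    cocycle j = record
      { to   = λ (t , f) → (f ⟨$⟩ t) X.⁻¹ X.∙ p j
      ; cong = λ { {t , f} {t′ , f′} (t≈t′ , f≈f′) →
                   X.∙-congʳ (X.⁻¹-cong (X.trans (Func.cong f t≈t′) (f≈f′ t′))) }
      }
    open Twisted em cocycle
    module E where
      open AbelianGroup total-group public
      open ℤ-Action total-group public
    module α = _≃_ (split twisted)

    ρ : E.Carrier → X.Carrier
    ρ e = proj₁ α.⟦ e ⟧

    ρ-hom : IsGroupHomomorphism E.rawGroup X.rawGroup ρ
    ρ-hom = mkHom total-group X ρ (λ e≈e′ → proj₁ (α.⟦⟧-cong e≈e′)) (λ e e′ → proj₁ (α.homo e e′))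

    h : Branch
    h n = record
      { to   = λ t → ρ (var (node n t))
      ; cong = λ t≈t′ → IsGroupHomomorphism.⟦⟧-cong ρ-hom
          ((λ (k , u) → at-node-cong (n ℕ.≟ k) u t≈t′) , 0 , λ _ _ → X.refl)
      }
      where
      at-node-cong : ∀ {n k} (d : Dec (n ≡ k)) u {t t′} → Setoid._≈_ (Node n) t t′ →
                     at-node d u t ≡ at-node d u t′
      at-node-cong (yes ≡.refl) u t≈t′ = Func.cong u t≈t′
      at-node-cong (no _)       u _    = ≡.refl

    z : ℕ → X.Carrier
    z n = ρ (var (branch h n))

    z-unfold : ∀ n → z n X.≈ p n X.∙ suc n X.∗ z (suc n)
    z-unfold n = begin
      z n
        ≈⟨ ρ.⟦⟧-cong (branch-unfold h n) ⟩
      ρ (suc n E.∗ y E.∙ (t E.∙ var (element (twist h n))))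
        ≈⟨ X.trans (ρ.homo _ _) (X.∙-cong (hom-× total-group X ρ-hom (suc n) y)
             (X.trans (ρ.homo _ _) (X.∙-congˡ (proj₁ (α.commutes-ι (twist h n)))))) ⟩
      -- By the choice of `h`, the value h(h|n) is `ρ t`, so the twist computes to
      -- `(ρ t) X.⁻¹ X.∙ p n`.
      suc n X.∗ z (suc n) X.∙ (ρ t X.∙ ((ρ t) X.⁻¹ X.∙ p n))
        ≈⟨ X.∙-congˡ (X.\\-leftDividesˡ (ρ t) (p n)) ⟩
      suc n X.∗ z (suc n) X.∙ p n
        ≈⟨ X.comm _ _ ⟩
      p n X.∙ suc n X.∗ z (suc n)
        ∎
      where
      open ≈-Reasoning X.setoid
      module ρ = IsGroupHomomorphism ρ-hom
      y = var (branch h (suc n))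
      t = var (node n (trunc h n))

-- Solvable groups have no nonzero maps to ℤ; the base group is torsion-free and cotorsion-free.

ℤ-∗ : let open ℤ-Action +-0-abelianGroup in ∀ n i → n ∗ i ≡ + n ℤ.* i
ℤ-∗ zero    i = ≡.sym (ℤ.*-zeroˡ i)
ℤ-∗ (suc n) i = ≡.trans (≡.cong (λ k → i ℤ.+ k) (ℤ-∗ n i)) (≡.sym (ℤ.suc-* (+ n) i))

-- Solve for the constant sequence x: the images w n in ℤ satisfy
-- (n + 1) w (n + 1) = w n - φ x, so they are bounded and eventually zero.

solvable⇒hom≡0 : (H : AbelianGroup a b) → Solvable H → let module H = AbelianGroup H in
                 ∀ {φ} → IsGroupHomomorphism H.rawGroup (AbelianGroup.rawGroup +-0-abelianGroup) φ →
                 ∀ x → φ x ≡ + 0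
solvable⇒hom≡0 H solve {φ} φ-hom x = begin
  -- Both `w (suc N)` and `w (suc (suc N))` vanish, so the recurrence between them leaves `φ x`.
  φ x                                         ≡⟨ ℤ.+-identityʳ (φ x) ⟨
  φ x ℤ.+ + 0                                 ≡⟨ ≡.cong (λ k → φ x ℤ.+ k) (ℤ.*-zeroʳ (+ suc (suc N))) ⟨
  φ x ℤ.+ + suc (suc N) ℤ.* + 0               ≡⟨ ≡.cong (λ k → φ x ℤ.+ + suc (suc N) ℤ.* k) (w≡0 (ℕ.n≤1+n N)) ⟨
  φ x ℤ.+ + suc (suc N) ℤ.* w (suc (suc N))   ≡⟨ w-unfold (suc N) ⟨
  w (suc N)                                   ≡⟨ w≡0 ℕ.≤-refl ⟩
  + 0                                         ∎
  where
  open ≡.≡-Reasoning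
  z = proj₁ (solve λ _ → x)
  w : ℕ → ℤ
  w n = φ (z n)
  w-unfold : ∀ n → w n ≡ φ x ℤ.+ + suc n ℤ.* w (suc n)
  w-unfold n = ≡.trans (IsGroupHomomorphism.⟦⟧-cong φ-hom (proj₂ (solve λ _ → x) n))
    (≡.trans (IsGroupHomomorphism.homo φ-hom _ _) (≡.cong (λ k → φ x ℤ.+ k)
      (≡.trans (hom-× H +-0-abelianGroup φ-hom (suc n) (z (suc n))) (ℤ-∗ (suc n) (w (suc n))))))
  ∣a∣ M N : ℕ
  ∣a∣ = ℤ.∣ φ x ∣
  M = ℤ.∣ w 0 ∣ ℕ.+ ∣a∣
  -- Beyond this bound a nonzero `w (suc n)` would give n + 1 ≤ (n + 1) |w (n + 1)| ≤ M + |a| = N ≤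
  -- n.
  N = M ℕ.+ ∣a∣
  contract : ∀ n → suc n ℕ.* ℤ.∣ w (suc n) ∣ ℕ.≤ ℤ.∣ w n ∣ ℕ.+ ∣a∣
  contract n = ≡.subst (ℕ._≤ ℤ.∣ w n ∣ ℕ.+ ∣a∣)
    (≡.trans (≡.cong ℤ.∣_∣ difference) (ℤ.abs-* (+ suc n) (w (suc n))))
    (ℤ.∣i-j∣≤∣i∣+∣j∣ (w n) (φ x))
    where
    difference : w n ℤ.- φ x ≡ + suc n ℤ.* w (suc n)
    difference = ≡.trans (≡.cong (ℤ._- φ x) (w-unfold n))
      (AbelianGroupProperties.xyx⁻¹≈y +-0-abelianGroup (φ x) (+ suc n ℤ.* w (suc n)))
  bounded : ∀ n → ℤ.∣ w n ∣ ℕ.≤ M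
  bounded zero          = ℕ.m≤m+n _ _
  bounded (suc zero)    = ≡.subst (ℕ._≤ M) (ℕ.*-identityˡ _) (contract 0)
  -- From index 2 on the factor is at least 2, and 2 |w| ≤ M + |a| ≤ 2 M.
  bounded (suc (suc n)) = ℕ.*-cancelˡ-≤ 2 (ℕ.≤-trans
    (ℕ.*-monoˡ-≤ ℤ.∣ w (suc (suc n)) ∣ (ℕ.s≤s (ℕ.s≤s (ℕ.z≤n {n}))))
    (ℕ.≤-trans (contract (suc n)) (ℕ.≤-trans (ℕ.+-mono-≤ (bounded (suc n)) (ℕ.m≤n+m ∣a∣ _))
      (ℕ.≤-reflexive (≡.cong (M ℕ.+_) (≡.sym (ℕ.+-identityʳ M)))))))
  w≡0 : ∀ {n} → N ℕ.≤ n → w (suc n) ≡ + 0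
  w≡0 {n} N≤n = ℤ.∣i∣≡0⇒i≡0 (abs≡0 (ℤ.∣ w (suc n) ∣) ≡.refl)
    where
    abs≡0 : ∀ k → ℤ.∣ w (suc n) ∣ ≡ k → k ≡ 0
    abs≡0 zero    _  = ≡.refl
    abs≡0 (suc k) eq = contradiction (ℕ.≤-trans (ℕ.m≤m*n (suc n) (suc k))
      (ℕ.≤-trans (≡.subst (λ i → suc n ℕ.* i ℕ.≤ ℤ.∣ w n ∣ ℕ.+ ∣a∣) eq (contract n))
        (ℕ.≤-trans (ℕ.+-monoˡ-≤ ∣a∣ (bounded n)) N≤n))) ℕ.1+n≰n

base-torsionFree : (X : AbelianGroup ℓ ℓ) → TorsionFree (Tree.base-group X)
base-torsionFree X (suc n) e ne≈ε i = ℤ.*-cancelˡ-≡ (+ suc n) (eval i e) (+ 0) (begin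
  + suc n ℤ.* eval i e      ≡⟨ ℤ-∗ (suc n) (eval i e) ⟨
  suc n ℤ′.∗ eval i e       ≡⟨ hom-× base-group +-0-abelianGroup (eval-hom i) (suc n) e ⟨
  eval i (suc n B.∗ e)      ≡⟨ ne≈ε i ⟩
  + 0                       ≡⟨ ℤ.*-zeroʳ (+ suc n) ⟨
  + suc n ℤ.* + 0           ∎)
  where
  open ≡.≡-Reasoning
  open Tree X
  module B = ℤ-Action base-group
  module ℤ′ = ℤ-Action +-0-abelianGroup

base-cotorsionFree : ExcludedMiddle ℓ → (X : AbelianGroup ℓ ℓ) → CotorsionFree (Tree.base-group X)
base-cotorsionFree em X S H-cotorsion x = injective λ i → ≡.trans
  (solvable⇒hom≡0 H H-solvable (incl-eval-hom i) x)
  (≡.sym (ε-homo i))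
  where
  open Tree X
  open Subgroup S renaming (group to H)
  open IsGroupMonomorphism isMonomorphism
  H-solvable : Solvable H
  H-solvable = Tree.ext≡0⇒solvable H em (H-cotorsion _ (base-torsionFree H))
  incl-eval-hom : ∀ i → IsGroupHomomorphism (AbelianGroup.rawGroup H)
                    (AbelianGroup.rawGroup +-0-abelianGroup) (eval i ∘ inclusion)
  incl-eval-hom i = mkHom H +-0-abelianGroup (eval i ∘ inclusion)
    (λ x≈y → ⟦⟧-cong x≈y i) (λ x y → IsGroupHomomorphism.homo isGroupHomomorphism x y i)

-- Splitting an extension by a complement.

record IsSubgroup (G : AbelianGroup a b) (M : Pred (AbelianGroup.Carrier G) p) : Set (a ⊔ b ⊔ p) where
  open AbelianGroup G
  field
    resp     : ∀ {x y} → x ≈ y → M x → M y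
    ε-closed : M ε
    ∙-closed : ∀ {x y} → M x → M y → M (x ∙ y)
    ⁻¹-closed : ∀ {x} → M x → M (x ⁻¹)

  open ℤ-Action G

  ∗-closed : ∀ n {x} → M x → M (n ∗ x)
  ∗-closed zero    _  = ε-closed
  ∗-closed (suc n) Mx = ∙-closed Mx (∗-closed n Mx)

-- The first component is the projection to `X` along `M`. Since `M` meets the image of `X`
-- trivially, the element given by `cover` is unique, which makes the projection well defined and
-- additive.
complement⇒split : {G X : AbelianGroup ℓ ℓ} (P : Extension G X) →
  let module P = Extension P ; module X = AbelianGroup X in
  (M : Pred P.E.Carrier p) → IsSubgroup P.E M → (∀ {x} → M (P.ι x) → x X.≈ X.ε) →
  (∀ e → ∃ λ x → M (e P.E.∙ P.ι x P.E.⁻¹)) → P ≃ 0ᴱ G X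
complement⇒split {G = G} {X} P M isSubgroup disjoint cover = record
  { hom = record
    { ⟦_⟧                 = λ e → ρ e , π e
    ; isGroupHomomorphism = mkHom P.E (DirectProduct.abelianGroup X G) _
        (λ e≈e′ → unique (resp (E.∙-congʳ e≈e′) (in-M _)) (in-M _) , P.π.⟦⟧-cong e≈e′)
        (λ e e′ → unique (in-M _) (resp (shuffle e e′) (∙-closed (in-M e) (in-M e′))) , P.π.homo e e′)
    }
  ; commutes-ι = λ x → unique (in-M (ι x)) (resp (E.sym (E.inverseʳ (ι x))) ε-closed) ,
      Equivalence.from (exact (ι x)) (x , E.refl)
  ; commutes-π = λ _ → G.refl
  }
  where
  open module P = Extension P using (ι; π; exact)
  module ι-hom = IsGroupHomomorphism (IsGroupMonomorphism.isGroupHomomorphism P.ι-isMonomorphism)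
  open IsSubgroup isSubgroup
  module E where
    open AbelianGroup P.E public
    open ℤ-Action P.E public
  module X where
    open AbelianGroup X public
    open ℤ-Action X public
  module G = AbelianGroup G
  ρ : E.Carrier → X.Carrier
  ρ e = proj₁ (cover e)
  in-M : ∀ e → M (e E.∙ ι (ρ e) E.⁻¹)
  in-M e = proj₂ (cover e)

  unique : ∀ {e x y} → M (e E.∙ ι x E.⁻¹) → M (e E.∙ ι y E.⁻¹) → x X.≈ y
  unique {e} {x} {y} Mx My = X.sym (X.x∙y⁻¹≈ε⇒x≈y y x (disjoint (resp (begin
    (e E.∙ ι x E.⁻¹) E.∙ (e E.∙ ι y E.⁻¹) E.⁻¹
      ≈⟨ E.∙-congˡ (E.⁻¹-∙-comm e (ι y E.⁻¹)) ⟨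
    (e E.∙ ι x E.⁻¹) E.∙ (e E.⁻¹ E.∙ (ι y E.⁻¹) E.⁻¹)
      ≈⟨ E.interchange e (ι x E.⁻¹) (e E.⁻¹) ((ι y E.⁻¹) E.⁻¹) ⟩
    (e E.∙ e E.⁻¹) E.∙ (ι x E.⁻¹ E.∙ (ι y E.⁻¹) E.⁻¹)
      ≈⟨ E.∙-cong (E.inverseʳ e) (E.comm _ _) ⟩
    E.ε E.∙ ((ι y E.⁻¹) E.⁻¹ E.∙ ι x E.⁻¹)
      ≈⟨ E.identityˡ _ ⟩
    (ι y E.⁻¹) E.⁻¹ E.∙ ι x E.⁻¹
      ≈⟨ E.∙-cong (E.⁻¹-involutive (ι y)) (E.sym (ι-hom.⁻¹-homo x)) ⟩
    ι y E.∙ ι (x X.⁻¹)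
      ≈⟨ ι-hom.homo y (x X.⁻¹) ⟨
    ι (y X.∙ x X.⁻¹)
      ∎) (∙-closed Mx (⁻¹-closed My)))))
    where open ≈-Reasoning E.setoid

  shuffle : ∀ e e′ → (e E.∙ ι (ρ e) E.⁻¹) E.∙ (e′ E.∙ ι (ρ e′) E.⁻¹) E.≈
                     (e E.∙ e′) E.∙ ι (ρ e X.∙ ρ e′) E.⁻¹
  shuffle e e′ = E.trans (E.interchange _ _ _ _) (E.∙-congˡ (E.trans (E.⁻¹-∙-comm _ _)
    (E.⁻¹-cong (E.sym (ι-hom.homo (ρ e) (ρ e′))))))

-- The rational numbers as an abelian group.

liftGroup : ∀ ℓ → AbelianGroup a b → AbelianGroup (ℓ ⊔ a) (ℓ ⊔ b)
liftGroup ℓ G = record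
  { isAbelianGroup = GroupMonomorphism.isAbelianGroup lower-isMonomorphism G.isAbelianGroup }
  where
  module G = AbelianGroup G
  lifted : RawGroup _ _
  lifted = record
    { Carrier = Lift ℓ G.Carrier
    ; _≈_     = λ x y → Lift ℓ (lower x G.≈ lower y)
    ; _∙_     = λ x y → lift (lower x G.∙ lower y)
    ; ε       = lift G.ε
    ; _⁻¹     = λ x → lift (lower x G.⁻¹)
    }
  lower-isMonomorphism : IsGroupMonomorphism lifted G.rawGroup lower
  lower-isMonomorphism = record
    { isGroupHomomorphism = record
      { isMonoidHomomorphism = record
        { isMagmaHomomorphism = record
          { isRelHomomorphism = record { cong = lower }
          ; homo              = λ _ _ → G.refl
          }
        ; ε-homo = G.refl
        }
      ; ⁻¹-homo = λ _ → G.refl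
      }
    ; injective = lift
    }

module Rationals (ℓ : Level) where
  private module ℚ₀ = ℤ-Action ℚ.+-0-abelianGroup

  Q : AbelianGroup ℓ ℓ
  Q = liftGroup ℓ ℚ.+-0-abelianGroup

  open AbelianGroup Q public
  open ℤ-Action Q public
  open ≈-Reasoning setoid

  lower-hom : IsGroupHomomorphism rawGroup (AbelianGroup.rawGroup ℚ.+-0-abelianGroup) lower
  lower-hom = mkHom Q ℚ.+-0-abelianGroup lower lower λ _ _ → ℚ.≃-refl

  one : Carrier
  one = lift 1ℚᵘ

  one≉ε : ¬ one ≈ ε
  one≉ε (lift 1≃0) = ℚ.0≄1 (ℚ.≃-sym 1≃0)

  ∗-ℚ : ∀ n x → n ℚ₀.∗ x ℚ.≃ mkℚᵘ (+ n) 0 ℚ.* x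
  ∗-ℚ zero    x = ℚ.≃-sym (ℚ.*-zeroˡ x)
  ∗-ℚ (suc n) x = ℚ.≃-sym (ℚ.≃-trans (ℚ.*-congʳ {x} 1+n)
    (ℚ.≃-trans (ℚ.*-distribʳ-+ x 1ℚᵘ (mkℚᵘ (+ n) 0))
      (ℚ.+-cong (ℚ.*-identityˡ x) (ℚ.≃-sym (∗-ℚ n x)))))
    where
    1+n : mkℚᵘ (+ suc n) 0 ℚ.≃ 1ℚᵘ ℚ.+ mkℚᵘ (+ n) 0
    1+n = *≡* (≡.cong (ℤ._* + 1) (≡.cong (λ k → + 1 ℤ.+ k) (≡.sym (ℤ.*-identityʳ (+ n)))))

  ·-one : ∀ i → i · one ≈ lift (mkℚᵘ i 0)
  ·-one (+ n)    = lift (ℚ.≃-trans (hom-× Q ℚ.+-0-abelianGroup lower-hom n one)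
    (ℚ.≃-trans (∗-ℚ n 1ℚᵘ) (ℚ.*-identityʳ _)))
  ·-one -[1+ n ] = ⁻¹-cong (·-one (+ suc n))

  infixl 7 _÷1+_
  _÷1+_ : Carrier → ℕ → Carrier
  x ÷1+ n = lift (mkℚᵘ (+ 1) n ℚ.* lower x)

  ÷-hom : ∀ n → IsGroupHomomorphism rawGroup rawGroup (_÷1+ n)
  ÷-hom n = mkHom Q Q (_÷1+ n) (λ x≈y → lift (ℚ.*-congˡ {mkℚᵘ (+ 1) n} (lower x≈y)))
    (λ x y → lift (ℚ.*-distribˡ-+ (mkℚᵘ (+ 1) n) (lower x) (lower y)))

  ∗-÷ : ∀ n x → suc n ∗ (x ÷1+ n) ≈ x
  ∗-÷ n x = lift (ℚ.≃-trans (hom-× Q ℚ.+-0-abelianGroup lower-hom (suc n) (x ÷1+ n))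
    (ℚ.≃-trans (∗-ℚ (suc n) (mkℚᵘ (+ 1) n ℚ.* lower x))
    (ℚ.≃-trans (ℚ.≃-sym (ℚ.*-assoc (mkℚᵘ (+ suc n) 0) (mkℚᵘ (+ 1) n) (lower x)))
    (ℚ.≃-trans (ℚ.*-congʳ {lower x} unit) (ℚ.*-identityˡ (lower x))))))
    where
    unit : mkℚᵘ (+ suc n) 0 ℚ.* mkℚᵘ (+ 1) n ℚ.≃ 1ℚᵘ
    unit = ℚ.*-inverseʳ (mkℚᵘ (+ suc n) 0)

  ÷-∗ : ∀ n x → (suc n ∗ x) ÷1+ n ≈ x
  ÷-∗ n x = trans (hom-× Q Q (÷-hom n) (suc n) x) (∗-÷ n x)

  ∗-cancel : ∀ n {x y} → suc n ∗ x ≈ suc n ∗ y → x ≈ y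
  ∗-cancel n nx≈ny = trans (sym (÷-∗ n _))
    (trans (IsGroupHomomorphism.⟦⟧-cong (÷-hom n) nx≈ny) (÷-∗ n _))

  ·-torsionFree : ∀ {i x} → ¬ i ≡ + 0 → i · x ≈ ε → x ≈ ε
  ·-torsionFree {+ zero}    i≢0 _    = contradiction ≡.refl i≢0
  ·-torsionFree {+ suc n}   _   nx≈ε = ∗-cancel n (trans nx≈ε (sym (IsGroupHomomorphism.ε-homo (·-hom (+ suc n)))))
  ·-torsionFree { -[1+ n ]} _   nx≈ε = ·-torsionFree {+ suc n} (λ ())
    (trans (sym (⁻¹-involutive _)) (trans (⁻¹-cong nx≈ε) ε⁻¹≈ε))

  ·-divisible : ∀ {i} x → ¬ i ≡ + 0 → ∃ λ y → i · y ≈ x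
  ·-divisible {+ zero}    x i≢0 = contradiction ≡.refl i≢0
  ·-divisible {+ suc n}   x _   = x ÷1+ n , ∗-÷ n x
  ·-divisible { -[1+ n ]} x _   = (x ⁻¹) ÷1+ n , trans (⁻¹-cong (∗-÷ n (x ⁻¹))) (⁻¹-involutive x)

  -- These generate ℚ subject to 1/n! = (n + 1) (1/(n+1)!), the homogeneous form of the systems in
  -- `Solvable`.
  1/_! : ℕ → Carrier
  1/ zero  ! = one
  1/ suc n ! = 1/ n ! ÷1+ n

  !∗1/! : ∀ n → (n !) ∗ 1/ n ! ≈ one
  !∗1/! zero    = identityʳ one
  !∗1/! (suc n) = begin
    (suc n ℕ.* n !) ∗ 1/ suc n !    ≡⟨ ≡.cong (_∗ 1/ suc n !) (ℕ.*-comm (suc n) (n !)) ⟩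
    (n ! ℕ.* suc n) ∗ 1/ suc n !    ≈⟨ ×-assocˡ _ (n !) (suc n) ⟨
    (n !) ∗ (suc n ∗ 1/ suc n !)    ≈⟨ ×-congʳ (n !) (∗-÷ n (1/ n !)) ⟩
    (n !) ∗ 1/ n !                  ≈⟨ !∗1/! n ⟩
    one                             ∎

  1/!≉ε : ∀ n → ¬ 1/ n ! ≈ ε
  1/!≉ε n 1/n!≈ε = one≉ε (trans (sym (!∗1/! n)) (trans (×-congʳ (n !) 1/n!≈ε)
    (IsGroupHomomorphism.ε-homo (·-hom (+ (n !))))))

  -- The denominator of `mkℚᵘ a d` is d + 1, and a / (d + 1) = a d! / (d + 1)!.
  generate : ∀ x → ∃ λ i → ∃ λ n → x ≈ i · 1/ n !
  generate (lift (mkℚᵘ a d)) = a ℤ.* + (d !) , suc d , (begin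
    lift (mkℚᵘ a d)                        ≈⟨ lift (ℚ.≃-reflexive (≡.cong₂ mkℚᵘ
                                                (≡.sym (ℤ.*-identityˡ a)) (≡.sym (ℕ.*-identityʳ d)))) ⟩
    lift (mkℚᵘ a 0) ÷1+ d                  ≈⟨ IsGroupHomomorphism.⟦⟧-cong (÷-hom d) (·-one a) ⟨
    (a · one) ÷1+ d                        ≈⟨ hom-· Q Q (÷-hom d) a one ⟩
    a · (one ÷1+ d)                        ≈⟨ ·-congʳ a (IsGroupHomomorphism.⟦⟧-cong (÷-hom d) (!∗1/! d)) ⟨
    a · (((d !) ∗ 1/ d !) ÷1+ d)           ≈⟨ ·-congʳ a (hom-× Q Q (÷-hom d) (d !) (1/ d !)) ⟩
    a · ((d !) ∗ 1/ suc d !)               ≈⟨ ·-assoc-× a (d !) (1/ suc d !) ⟨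
    (a ℤ.* + (d !)) · 1/ suc d !           ∎)

-- Extensions of ℚ by a solvable group split.

module _ {X : AbelianGroup ℓ ℓ} (P : Extension (Rationals.Q ℓ) X) where
  private
    module Q = Rationals ℓ
    module X where
      open AbelianGroup X public
      open ℤ-Action X public
    module P = Extension P
    module E where
      open AbelianGroup P.E public
      open ℤ-Action P.E public
    ι-hom = IsGroupMonomorphism.isGroupHomomorphism P.ι-isMonomorphism
    module ι-hom = IsGroupHomomorphism ι-hom

  kernel : ∀ {e e′} → P.π e Q.≈ P.π e′ → ∃ λ x → P.ι x E.∙ e′ E.≈ e
  kernel {e} {e′} πe≈πe′ = proj₁ preimage ,
    E.trans (E.∙-congʳ (proj₂ preimage)) (E.//-rightDividesˡ e′ e)
    where
    preimage = Equivalence.to (P.exact (e E.∙ e′ E.⁻¹)) (Q.trans (P.π.homo _ _)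
      (Q.trans (Q.∙-cong πe≈πe′ (P.π.⁻¹-homo e′)) (Q.inverseʳ (P.π e′))))

  module _ (v : ℕ → E.Carrier) (πv : ∀ n → P.π (v n) Q.≈ Q.1/ n !)
           (v-suc : ∀ n → v n E.≈ suc n E.∗ v (suc n)) where
    open ≈-Reasoning E.setoid

    v-multiple : ∀ n k → ∃ λ N → v n E.≈ N E.∗ v (k ℕ.+ n)
    v-multiple n zero    = 1 , E.sym (E.×-homo-1 _)
    v-multiple n (suc k) =
      let N , vn≈ = v-multiple n k
      in N ℕ.* suc (k ℕ.+ n) ,
         E.trans vn≈ (E.trans (E.×-congʳ N (v-suc (k ℕ.+ n))) (E.×-assocˡ _ N _))

    -- Each `v n` is a multiple of every later one, so this union of cyclic groups is directed.
    Span : Pred E.Carrier ℓ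
    Span e = ∃ λ i → ∃ λ n → e E.≈ i E.· v n

    raise : ∀ i n k → ∃ λ j → i E.· v n E.≈ j E.· v (k ℕ.+ n)
    raise i n k =
      let N , vn≈ = v-multiple n k
      in i ℤ.* + N , E.trans (E.·-congʳ i vn≈) (E.sym (E.·-assoc-× i N _))

    span-subgroup : IsSubgroup P.E Span
    span-subgroup = record
      { resp      = λ { e≈e′ (i , n , e≈) → i , n , E.trans (E.sym e≈e′) e≈ }
      ; ε-closed  = + 0 , 0 , E.refl
      ; ∙-closed  = λ { {e} {e′} (i , m , e≈) (j , n , e′≈) →
          let i′ , ivm≈ = raise i m n
              j′ , jvn≈ = raise j n m
          in i′ ℤ.+ j′ , n ℕ.+ m , (begin
            e E.∙ e′
              ≈⟨ E.∙-cong (E.trans e≈ ivm≈) (E.trans e′≈ jvn≈) ⟩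
            i′ E.· v (n ℕ.+ m) E.∙ j′ E.· v (m ℕ.+ n)
              ≡⟨ ≡.cong (λ k → i′ E.· v (n ℕ.+ m) E.∙ j′ E.· v k) (ℕ.+-comm m n) ⟩
            i′ E.· v (n ℕ.+ m) E.∙ j′ E.· v (n ℕ.+ m)
              ≈⟨ E.·-homo-+ _ i′ j′ ⟨
            (i′ ℤ.+ j′) E.· v (n ℕ.+ m)
              ∎) }
      ; ⁻¹-closed = λ { (i , n , e≈) → ℤ.- i , n , E.trans (E.⁻¹-cong e≈) (E.sym (E.·-neg i _)) }
      }

    span-disjoint : ∀ {x} → Span (P.ι x) → x X.≈ X.ε
    span-disjoint {x} (i , n , ιx≈) with i ℤ.≟ + 0
    ... | yes ≡.refl = IsGroupMonomorphism.injective P.ι-isMonomorphism (E.trans ιx≈ (E.sym ι-hom.ε-homo))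
    -- Applying `P.π` would make a nonzero multiple of 1/n! vanish in ℚ.
    ... | no i≢0 = contradiction (Q.·-torsionFree i≢0 (Q.trans (Q.·-congʳ i (Q.sym (πv n)))
      (Q.trans (Q.sym (hom-· P.E Q.Q P.π-isHomomorphism i (v n)))
        (Q.trans (P.π.⟦⟧-cong (E.sym ιx≈)) (Equivalence.from (P.exact _) (x , E.refl)))))) (Q.1/!≉ε n)

    span-cover : ∀ e → ∃ λ x → Span (e E.∙ P.ι x E.⁻¹)
    span-cover e =
      let i , n , πe≈   = Q.generate (P.π e)
          x , ιx∙ivn≈e = kernel (Q.trans πe≈ (Q.trans (Q.·-congʳ i (Q.sym (πv n)))
                            (Q.sym (hom-· P.E Q.Q P.π-isHomomorphism i (v n)))))
      in x , i , n , E.trans (E.∙-congʳ (E.sym ιx∙ivn≈e)) (E.xyx⁻¹≈y (P.ι x) (i E.· v n))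

    factorial-sequence⇒split : P ≃ 0ᴱ Q.Q X
    factorial-sequence⇒split = complement⇒split P Span span-subgroup span-disjoint span-cover

  -- Arbitrary lifts `y n` of 1/n! satisfy the relations of ℚ up to defects in `X`. Solving the
  -- system for these defects gives corrections `z n`, after which the relations hold exactly.
  solvable⇒split : Solvable X → P ≃ 0ᴱ Q.Q X
  solvable⇒split X-solvable = factorial-sequence⇒split v πv v-suc
    where
    open ≈-Reasoning E.setoid

    y : ℕ → E.Carrier
    y n = proj₁ (P.π-surjective (Q.1/ n !))

    πy : ∀ n → P.π (y n) Q.≈ Q.1/ n !
    πy n = proj₂ (P.π-surjective (Q.1/ n !)) E.refl

    defect : ∀ n → ∃ λ x → P.ι x E.∙ suc n E.∗ y (suc n) E.≈ y n
    defect n = kernel (Q.trans (πy n) (Q.sym (Q.trans (hom-× P.E Q.Q P.π-isHomomorphism (suc n) (y (suc n)))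
      (Q.trans (Q.×-congʳ (suc n) (πy (suc n))) (Q.∗-÷ n (Q.1/ n !))))))

    correction = X-solvable (proj₁ ∘ defect)
    z = proj₁ correction

    v : ℕ → E.Carrier
    v n = y n E.∙ P.ι (z n) E.⁻¹

    πv : ∀ n → P.π (v n) Q.≈ Q.1/ n !
    πv n = Q.trans (P.π.homo _ _) (Q.trans (Q.∙-cong (πy n) (Q.trans (P.π.⁻¹-homo _)
      (Q.trans (Q.⁻¹-cong (Equivalence.from (P.exact _) (z n , E.refl))) Q.ε⁻¹≈ε))) (Q.identityʳ _))

    v-suc : ∀ n → v n E.≈ suc n E.∗ v (suc n)
    v-suc n = begin
      y n E.∙ P.ι (z n) E.⁻¹
        ≈⟨ E.∙-cong (E.sym (proj₂ (defect n))) (E.⁻¹-cong (E.trans (ι-hom.⟦⟧-cong (proj₂ correction n))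
             (E.trans (ι-hom.homo _ _) (E.∙-congˡ (hom-× X P.E ι-hom (suc n) (z (suc n))))))) ⟩
      (ιd E.∙ sy) E.∙ (ιd E.∙ sz) E.⁻¹
        ≈⟨ E.∙-congˡ (E.⁻¹-∙-comm ιd sz) ⟨
      (ιd E.∙ sy) E.∙ (ιd E.⁻¹ E.∙ sz E.⁻¹)
        ≈⟨ E.interchange ιd sy (ιd E.⁻¹) (sz E.⁻¹) ⟩
      (ιd E.∙ ιd E.⁻¹) E.∙ (sy E.∙ sz E.⁻¹)
        ≈⟨ E.trans (E.∙-congʳ (E.inverseʳ ιd)) (E.identityˡ _) ⟩
      sy E.∙ sz E.⁻¹
        ≈⟨ E.∙-congˡ (hom-× P.E P.E E.⁻¹-hom (suc n) (P.ι (z (suc n)))) ⟩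
      sy E.∙ suc n E.∗ (P.ι (z (suc n)) E.⁻¹)
        ≈⟨ E.×-distrib-+ _ _ (suc n) ⟨
      suc n E.∗ v (suc n)
        ∎
      where
      ιd = P.ι (proj₁ (defect n))
      sy = suc n E.∗ y (suc n)
      sz = suc n E.∗ P.ι (z (suc n))

solvable⇒ext≡0 : (X : AbelianGroup ℓ ℓ) → Solvable X → Ext≡0 (Rationals.Q ℓ) X
solvable⇒ext≡0 X X-solvable P = solvable⇒split P X-solvable

-- Extensions of torsion-free groups by ℚ split.

module _ (choice : AxiomOfChoice ℓ) (J : AbelianGroup ℓ ℓ) (J-torsionFree : TorsionFree J)
         (P : Extension J (Rationals.Q ℓ)) where
  private
    module Q = Rationals ℓ
    module J = AbelianGroup J
    module P = Extension P
    module E where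
      open AbelianGroup P.E public
      open ℤ-Action P.E public
    ι-hom = IsGroupMonomorphism.isGroupHomomorphism P.ι-isMonomorphism
    module ι-hom = IsGroupHomomorphism ι-hom

    em : ExcludedMiddle ℓ
    em = choice⇒em choice

  -- Candidates for a complement of ℚ. Purity allows division by nonzero integers inside `M`.
  record Independent (M : Pred E.Carrier p) : Set (ℓ ⊔ p) where
    field
      isSubgroup : IsSubgroup P.E M
      disjoint   : ∀ {x} → M (P.ι x) → x Q.≈ Q.ε
      pure       : ∀ n {e} → M (suc n E.∗ e) → M e
    open IsSubgroup isSubgroup public

  independent-resp : {M : Pred E.Carrier p} {N : Pred E.Carrier q} → M ⊆ N → N ⊆ M →
                     Independent M → Independent N
  independent-resp M⊆N N⊆M ind = record
    { isSubgroup = record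
      { resp      = λ e≈e′ Ne → M⊆N (M.resp e≈e′ (N⊆M Ne))
      ; ε-closed  = M⊆N M.ε-closed
      ; ∙-closed  = λ Ne Ne′ → M⊆N (M.∙-closed (N⊆M Ne) (N⊆M Ne′))
      ; ⁻¹-closed = λ Ne → M⊆N (M.⁻¹-closed (N⊆M Ne))
      }
    ; disjoint = λ Nιx → M.disjoint (N⊆M Nιx)
    ; pure     = λ n Nne → M⊆N (M.pure n (N⊆M Nne))
    }
    where module M = Independent ind

  -- Purity of zero says that `P.E` is torsion-free, which it inherits from `J` and ℚ.
  zero-independent : Independent (E._≈ E.ε)
  zero-independent = record
    { isSubgroup = record
      { resp      = λ e≈e′ e≈ε → E.trans (E.sym e≈e′) e≈ε
      ; ε-closed  = E.refl
      ; ∙-closed  = λ e≈ε e′≈ε → E.trans (E.∙-cong e≈ε e′≈ε) (E.identityˡ E.ε)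
      ; ⁻¹-closed = λ e≈ε → E.trans (E.⁻¹-cong e≈ε) E.ε⁻¹≈ε
      }
    ; disjoint = ι≈ε
    ; pure     = λ n {e} ne≈ε →
        let x , ιx≈e = Equivalence.to (P.exact e) (J-torsionFree (suc n) (P.π e)
              (J.trans (J.sym (hom-× P.E J P.π-isHomomorphism (suc n) e))
                (J.trans (P.π.⟦⟧-cong ne≈ε) P.π.ε-homo)))
            nx≈ε = ι≈ε (E.trans (hom-× Q.Q P.E ι-hom (suc n) x)
                     (E.trans (E.×-congʳ (suc n) ιx≈e) ne≈ε))
        in E.trans (E.sym ιx≈e) (E.trans (ι-hom.⟦⟧-cong (Q.·-torsionFree {+ suc n} (λ ()) nx≈ε)) ι-hom.ε-homo)
    }
    where
    ι≈ε : ∀ {x} → P.ι x E.≈ E.ε → x Q.≈ Q.ε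
    ι≈ε ιx≈ε = IsGroupMonomorphism.injective P.ι-isMonomorphism (E.trans ιx≈ε (E.sym ι-hom.ε-homo))

  reify : Pred E.Carrier ℓ → E.Carrier → Bool
  reify M e = isYes (em {M e})

  -- Boolean membership keeps the ordered set in `Set ℓ`, as Zorn's lemma requires.
  IndependentSet : Set ℓ
  IndependentSet = Σ[ S ∈ (E.Carrier → Bool) ] Independent (T ∘ S)

  _∈′_ : E.Carrier → IndependentSet → Set
  e ∈′ (S , _) = T (S e)

  _⊑_ : Rel IndependentSet ℓ
  A ⊑ B = ∀ {e} → e ∈′ A → e ∈′ B

  reify-independent : {M : Pred E.Carrier ℓ} → Independent M → IndependentSet
  reify-independent {M} ind = reify M , independent-resp fromWitness toWitness ind

  open Zorn choice IndependentSet _⊑_ id (λ A⊑B B⊑C → B⊑C ∘ A⊑B)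

  union : Pred IndependentSet ℓ → Pred E.Carrier ℓ
  union C e = ∃ λ A → C A × e ∈′ A

  -- Closure under the group operation involves two members, which the chain condition places in
  -- one; the other conditions are checked in a single member.
  union-independent : ∀ C → ∃ C → Chain C → Independent (union C)
  union-independent C (A₀ , CA₀) chain = record
    { isSubgroup = record
      { resp      = λ { e≈e′ (A , CA , e∈A) → A , CA , resp A e≈e′ e∈A }
      ; ε-closed  = A₀ , CA₀ , ε-closed A₀
      ; ∙-closed  = λ { (A , CA , e∈A) (B , CB , e′∈B) → common A B CA CB e∈A e′∈B (chain CA CB) }
      ; ⁻¹-closed = λ { (A , CA , e∈A) → A , CA , ⁻¹-closed A e∈A }
      }
    ; disjoint = λ { (A , CA , ιx∈A) → disjoint A ιx∈A }
    ; pure     = λ { n (A , CA , ne∈A) → A , CA , pure A n ne∈A }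
    }
    where
    open module Members (A : IndependentSet) = Independent (proj₂ A)
    common : ∀ {e e′} A B → C A → C B → e ∈′ A → e′ ∈′ B → A ⊑ B ⊎ B ⊑ A → union C (e E.∙ e′)
    common A B CA CB e∈A e′∈B (inj₁ A⊑B) = B , CB , ∙-closed B (A⊑B e∈A) e′∈B
    common A B CA CB e∈A e′∈B (inj₂ B⊑A) = A , CA , ∙-closed A e∈A (B⊑A e′∈B)

  union-lub : ∀ C → ∃ C → Chain C → ∃ (IsLub C)
  union-lub C inhabited chain = reify-independent (union-independent C inhabited chain) ,
    (λ {A} CA e∈A → fromWitness (A , CA , e∈A)) ,
    λ {B} below e∈⋃C → let A , CA , e∈A = toWitness e∈⋃C in below CA e∈A

  module _ {M : Pred E.Carrier p} (ind : Independent M) (e : E.Carrier) where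
    open Independent ind
    open ≈-Reasoning E.setoid

    -- The pure closure of the subgroup generated by `M` and `e`.
    hull : Pred E.Carrier p
    hull x = ∃ λ k → ∃ λ i → M (suc k E.∗ x E.∙ i E.· e)

    multiple : ∀ k l i x → M (k E.∗ x E.∙ i E.· e) → M ((l ℕ.* k) E.∗ x E.∙ (i ℤ.* + l) E.· e)
    multiple k l i x = resp (begin
      l E.∗ (k E.∗ x E.∙ i E.· e)
        ≈⟨ E.×-distrib-+ _ _ l ⟩
      l E.∗ (k E.∗ x) E.∙ l E.∗ (i E.· e)
        ≈⟨ E.∙-cong (E.×-assocˡ x l k) (hom-· P.E P.E (E.·-hom (+ l)) i e) ⟩
      (l ℕ.* k) E.∗ x E.∙ i E.· (l E.∗ e)
        ≈⟨ E.∙-congˡ (E.·-assoc-× i l e) ⟨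
      (l ℕ.* k) E.∗ x E.∙ (i ℤ.* + l) E.· e
        ∎) ∘ ∗-closed l

    hull-subgroup : IsSubgroup P.E hull
    hull-subgroup = record
      { resp      = λ { x≈y (k , i , Mx) → k , i , resp (E.∙-congʳ (E.×-congʳ (suc k) x≈y)) Mx }
      ; ε-closed  = 0 , + 0 , resp (E.sym (E.trans (E.identityʳ _) (E.identityʳ _))) ε-closed
      ; ∙-closed  = λ { {x} {y} (k , i , Mx) (l , j , My) →
          -- The successor of the first number is `suc k ℕ.* suc l`, a common multiple of both
          -- coefficients.
          l ℕ.+ k ℕ.* suc l , i ℤ.* + suc l ℤ.+ j ℤ.* + suc k ,
          resp (begin
            ((suc l ℕ.* suc k) E.∗ x E.∙ (i ℤ.* + suc l) E.· e) E.∙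
            ((suc k ℕ.* suc l) E.∗ y E.∙ (j ℤ.* + suc k) E.· e)
              ≈⟨ E.interchange _ _ _ _ ⟩
            ((suc l ℕ.* suc k) E.∗ x E.∙ (suc k ℕ.* suc l) E.∗ y) E.∙
            ((i ℤ.* + suc l) E.· e E.∙ (j ℤ.* + suc k) E.· e)
              ≈⟨ E.∙-cong (E.∙-congʳ (E.×-congˡ (ℕ.*-comm (suc l) (suc k))))
                   (E.sym (E.·-homo-+ e (i ℤ.* + suc l) (j ℤ.* + suc k))) ⟩
            ((suc k ℕ.* suc l) E.∗ x E.∙ (suc k ℕ.* suc l) E.∗ y) E.∙
            (i ℤ.* + suc l ℤ.+ j ℤ.* + suc k) E.· e
              ≈⟨ E.∙-congʳ (E.×-distrib-+ x y (suc k ℕ.* suc l)) ⟨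
            (suc k ℕ.* suc l) E.∗ (x E.∙ y) E.∙ (i ℤ.* + suc l ℤ.+ j ℤ.* + suc k) E.· e
              ∎) (∙-closed (multiple (suc k) (suc l) i x Mx) (multiple (suc l) (suc k) j y My)) }
      ; ⁻¹-closed = λ { {x} (k , i , Mx) → k , ℤ.- i , resp (begin
          (suc k E.∗ x E.∙ i E.· e) E.⁻¹
            ≈⟨ E.⁻¹-∙-comm _ _ ⟨
          (suc k E.∗ x) E.⁻¹ E.∙ (i E.· e) E.⁻¹
            ≈⟨ E.∙-cong (hom-× P.E P.E E.⁻¹-hom (suc k) x) (E.sym (E.·-neg i e)) ⟩
          suc k E.∗ (x E.⁻¹) E.∙ (ℤ.- i) E.· e
            ∎) (⁻¹-closed Mx) }
      }

    hull-pure : ∀ n {x} → hull (suc n E.∗ x) → hull x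
    hull-pure n {x} (k , i , Mx) =
      n ℕ.+ k ℕ.* suc n , i , resp (E.∙-congʳ (E.×-assocˡ x (suc k) (suc n))) Mx

    ⊆-hull : M ⊆ hull
    ⊆-hull Mx = 0 , + 0 , resp (E.sym (E.trans (E.identityʳ _) (E.identityʳ _))) Mx

    e∈hull : hull e
    e∈hull = 0 , -[1+ 0 ] , resp (E.sym (E.inverseʳ _)) ε-closed

    pure-· : ∀ {i x} → ¬ i ≡ + 0 → M (i E.· x) → M x
    pure-· {+ zero}    i≢0 _  = contradiction ≡.refl i≢0
    pure-· {+ suc n}   _   Mx = pure n Mx
    pure-· { -[1+ n ]} _   Mx = pure n (resp (E.⁻¹-involutive _) (⁻¹-closed Mx))

    -- If k x + i e ∈ M with x ≠ 0 in ℚ, then i ≠ 0, and dividing k x by i in ℚ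
    -- moves e into M + ℚ.
    hull-meets⇒cover : ∀ {x} → hull (P.ι x) → ¬ x Q.≈ Q.ε → ∃ λ y → M (e E.∙ P.ι y E.⁻¹)
    hull-meets⇒cover {x} (k , i , Mx) x≉ε with i ℤ.≟ + 0
    ... | yes ≡.refl = contradiction
      (Q.·-torsionFree {+ suc k} (λ ()) (disjoint (resp (E.trans (E.identityʳ _)
        (E.sym (hom-× Q.Q P.E ι-hom (suc k) x))) Mx))) x≉ε
    ... | no i≢0 = y Q.⁻¹ , resp (E.trans (E.comm _ _) (E.∙-congˡ (begin
        P.ι y                      ≈⟨ E.⁻¹-involutive _ ⟨
        (P.ι y E.⁻¹) E.⁻¹          ≈⟨ E.⁻¹-cong (ι-hom.⁻¹-homo y) ⟨
        P.ι (y Q.⁻¹) E.⁻¹          ∎))) (pure-· i≢0 (resp (begin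
        suc k E.∗ P.ι x E.∙ i E.· e
          ≈⟨ E.∙-congʳ (hom-× Q.Q P.E ι-hom (suc k) x) ⟨
        P.ι (suc k Q.∗ x) E.∙ i E.· e
          ≈⟨ E.∙-congʳ (ι-hom.⟦⟧-cong (proj₂ quotient)) ⟨
        P.ι (i Q.· y) E.∙ i E.· e
          ≈⟨ E.∙-congʳ (hom-· Q.Q P.E ι-hom i y) ⟩
        i E.· P.ι y E.∙ i E.· e
          ≈⟨ E.·-distribʳ i (P.ι y) e ⟨
        i E.· (P.ι y E.∙ e)
          ∎) Mx))
      where
      quotient = Q.·-divisible (suc k Q.∗ x) i≢0
      y = proj₁ quotient

  -- If the hull of `M` and `e` meets ℚ nontrivially, this already puts `e` into M + ℚ. Otherwise
  -- the hull is independent, and maximality puts `e` into `M`.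
  maximal⇒cover : {M : Pred E.Carrier 0ℓ} (ind : Independent M) →
                  (∀ {N : Pred E.Carrier 0ℓ} → Independent N → M ⊆ N → N ⊆ M) →
                  ∀ e → Dec (∃ λ x → hull ind e (P.ι x) × ¬ x Q.≈ Q.ε) →
                  ∃ λ x → M (e E.∙ P.ι x E.⁻¹)
  maximal⇒cover ind max e (yes (x , hull-ιx , x≉ε)) = hull-meets⇒cover ind e hull-ιx x≉ε
  maximal⇒cover {M} ind max e (no hull∩Q≈0) = Q.ε , resp
    (E.sym (E.trans (E.∙-congˡ (E.trans (E.⁻¹-cong ι-hom.ε-homo) E.ε⁻¹≈ε)) (E.identityʳ e)))
    (max hull-independent (⊆-hull ind e) (e∈hull ind e))
    where
    open Independent ind
    hull-independent : Independent (hull ind e)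
    hull-independent = record
      { isSubgroup = hull-subgroup ind e
      ; disjoint   = λ {x} hull-ιx → decidable-stable em λ x≉ε → hull∩Q≈0 (x , hull-ιx , x≉ε)
      ; pure       = hull-pure ind e
      }

  -- Zorn's lemma gives maximality among Boolean sets; excluded middle, applied to lifted
  -- predicates, extends it to all predicates of level zero.
  maximal-independent : Σ[ M ∈ Pred E.Carrier 0ℓ ] Independent M ×
                        (∀ {N : Pred E.Carrier 0ℓ} → Independent N → M ⊆ N → N ⊆ M)
  maximal-independent =
    let (S , ind) , max = zorn (reify-independent zero-independent) union-lub
    in T ∘ S , ind , λ N-ind M⊆N Ne →
         max (reify-independent (independent-resp (lift {ℓ = ℓ}) lower N-ind))
           (λ Me → fromWitness (lift (M⊆N Me))) (fromWitness (lift Ne))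

  split-by-ℚ : P ≃ 0ᴱ J Q.Q
  split-by-ℚ =
    let M , ind , max = maximal-independent
    in complement⇒split P M (Independent.isSubgroup ind) (Independent.disjoint ind)
         (λ e → maximal⇒cover ind max e em)

-- ℚ as a cotorsion group, and the contradiction.

Q-cotorsion : AxiomOfChoice ℓ → Cotorsion (Rationals.Q ℓ)
Q-cotorsion choice J J-torsionFree P = split-by-ℚ choice J J-torsionFree P

Q-not-cotorsionFree : AxiomOfChoice ℓ → ¬ CotorsionFree (Rationals.Q ℓ)
Q-not-cotorsionFree {ℓ} choice Q-free = one≉ε (Q-free record
  { group          = Q
  ; inclusion      = id
  ; isMonomorphism = record { isGroupHomomorphism = mkHom Q Q id id λ _ _ → refl ; injective = id }
  } (Q-cotorsion choice) one)
  where open Rationals ℓ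

corollary2p2 : (ℓ m : Level) → AxiomOfChoice ℓ →
    ¬ (∃ λ (C : Pred (AbelianGroup ℓ ℓ) m) → CotorsionFree ≐ ⊥ C)
corollary2p2 ℓ m choice (C , free⊆⊥C , ⊥C⊆free) = Q-not-cotorsionFree choice (⊥C⊆free λ X X∈C →
  solvable⇒ext≡0 X (Tree.ext≡0⇒solvable X em (free⊆⊥C (base-cotorsionFree em X) X X∈C)))
  where
  em : ExcludedMiddle ℓ
  em = choice⇒em choice
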